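{- Let $G=(V,E)$ be a finite graph, let $A,B,C\subseteq E$ be chosen independently and uniformly at random and let $\Delta$ be the event that $A\bigtriangleup B$ and $B\bigtriangleup C$ are both eulerian. Then $$\mathrm{Bias}(|A|+|B|+|C|\equiv 1\ (\mathrm{mod}\ 3)\mid\Delta)=\mathrm{Bias}(|A|+|B|+|C|\equiv 2\ (\mathrm{mod}\ 3)\mid\Delta)$$ and $$\frac{\mathrm{Bias}(|A|+|B|+|C|\equiv 0\ (\mathrm{mod}\ 3)\mid\Delta)-\mathrm{Bias}(|A|+|B|+|C|\equiv 1\ (\mathrm{mod}\ 3)\mid\Delta)}{\mathrm{Bias}(|A|+|B|+|C|\equiv 0\ (\mathrm{mod}\ 3))-\mathrm{Bias}(|A|+|B|+|C|\equiv 1\ (\mathrm{mod}\ 3))}=4^{r(G)}(-3)^{n(G)}\,T\!\left(G;-2,-\tfrac{1}{3}\right).$$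
   Context: Graphs are finite; loops and parallel edges are permitted. A subset $A\subseteq E$ is identified with the subgraph $(V,A)$ of $G$; it is called eulerian if all its vertex degrees are even (a loop contributes 2 to the degree). $\bigtriangleup$ is symmetric difference of sets. For $A\subseteq E$, $r(A)=|V|-k(A)$, where $k(A)$ is the number of connected components of $(V,A)$; $r(G)=r(E)$ and $n(G)=|E|-r(G)$. The Tutte polynomial is $T(G;x,y)=\sum_{A\subseteq E}(x-1)^{r(E)-r(A)}(y-1)^{|A|-r(A)}$. For an event $\Sigma$, $\mathrm{Bias}(\Sigma)=\mathbb{P}(\Sigma)-\mathbb{P}(\overline{\Sigma})$ and $\mathrm{Bias}(\Sigma\mid\Delta)=\mathbb{P}(\Sigma\mid\Delta)-\mathbb{P}(\overline{\Sigma}\mid\Delta)$, where $\overline{\Sigma}$ is the complement of $\Sigma$. -}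

module Defs where

open import Algebra.Definitions.RawMonoid using (sum)
open import Data.Bool.Base using (if_then_else_; _xor_)
open import Data.Fin.Base using (Fin)
open import Data.Fin.Properties using (_≟_; all?)
open import Data.Fin.Subset using (Subset; inside; outside; _∈_; ∣_∣)
  renaming (⊤ to full; ⊥ to ∅)
open import Data.Fin.Subset.Properties using (_∈?_)
open import Data.Integer.Base using (+_)
open import Data.List.Base
  using (List; []; _∷_; _++_; map; filter; foldr; length; allFin; deduplicate; cartesianProduct)
open import Data.List.Membership.Propositional using () renaming (_∈_ to _∈ˡ_)
open import Data.List.Membership.Propositional.Properties
  using (∈-map⁺; ∈-map⁻; ∈-filter⁺; ∈-filter⁻; ∈-++⁺ˡ; ∈-cartesianProduct⁺; ∈-allFin)
open import Data.List.Relation.Unary.Any using (here; there)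
open import Data.Nat.Base as ℕ using (ℕ; zero; suc; _∸_)
open import Data.Nat.DivMod using (_%_)
open import Data.Nat.Divisibility using (_∣_; _∣?_; _∣0)
import Data.Nat.Properties as ℕ
open import Data.Product.Base using (_×_; _,_; proj₁; proj₂; ∃-syntax)
open import Data.Rational.Base
  using (ℚ; 0ℚ; 1ℚ; _+_; _-_; _*_; _/_; _÷_; NonZero; +-*-rawSemiring)
import Data.Rational.Properties as ℚ
open import Data.Sum.Base using (_⊎_; inj₁; inj₂)
open import Data.Vec.Base using ([]; _∷_; lookup; zipWith)
open import Level using (0ℓ)
open import Relation.Binary.Construct.Closure.Equivalence as Eq using (EqClosure)
open import Relation.Binary.Construct.Closure.ReflexiveTransitive using (ε; _◅_; _◅◅_)
open import Relation.Binary.Construct.Closure.Symmetric using (fwd; bwd)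
open import Relation.Binary.Core using (Rel)
import Relation.Binary.Definitions as Binary
open import Relation.Binary.PropositionalEquality using (_≡_; refl; sym; subst)
open import Relation.Nullary.Decidable using (does; map′; _×-dec_; _⊎-dec_)
open import Relation.Unary using (Pred; Decidable)
open import Relation.Unary.Properties using (∁?; _∩?_)

open import Algebra.Definitions.RawSemiring +-*-rawSemiring public using (_^_)

------------------------------------------------------------------------
-- Graphs

-- The order of the two ends of an edge carries no meaning: everything below
-- is invariant under swapping them.  Loops and parallel edges are allowed.

record Graph : Set where
  field
    #V   : ℕ
    #E   : ℕ
    ends : Fin #E → Fin #V × Fin #V

infixl 6 _△_

_△_ : ∀ {m} → Subset m → Subset m → Subset m
_△_ = zipWith _xor_

subsets : ∀ m → List (Subset m)
subsets zero    = [] ∷ []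
subsets (suc m) = map (outside ∷_) (subsets m) ++ map (inside ∷_) (subsets m)

-- Connectivity along a list of edges, decided by adding one edge at a time.

module _ {n : ℕ} where

  Along : List (Fin n × Fin n) → Rel (Fin n) 0ℓ
  Along es u v = (u , v) ∈ˡ es

  Joined : Fin n × Fin n → List (Fin n × Fin n) → Rel (Fin n) 0ℓ
  Joined (a , b) es u v =
    let _~_ = EqClosure (Along es) in (u ~ v) ⊎ (u ~ a × b ~ v) ⊎ (u ~ b × a ~ v)

  module _ (a b : Fin n) (es : List (Fin n × Fin n)) where

    private
      symˡ : ∀ {u v} → EqClosure (Along es) u v → EqClosure (Along es) v u
      symˡ = Eq.symmetric (Along es)

      wk : ∀ {u v} → EqClosure (Along es) u v → EqClosure (Along ((a , b) ∷ es)) u v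
      wk = Eq.map there

    joined⇒eqClosure : ∀ {u v} → Joined (a , b) es u v → EqClosure (Along ((a , b) ∷ es)) u v
    joined⇒eqClosure (inj₁ p)              = wk p
    joined⇒eqClosure (inj₂ (inj₁ (p , q))) = wk p ◅◅ fwd (here refl) ◅ wk q
    joined⇒eqClosure (inj₂ (inj₂ (p , q))) = wk p ◅◅ bwd (here refl) ◅ wk q

    private
      step : ∀ {u v w} → EqClosure (Along es) u v → Joined (a , b) es v w → Joined (a , b) es u w
      step p (inj₁ q)              = inj₁ (p ◅◅ q)
      step p (inj₂ (inj₁ (q , r))) = inj₂ (inj₁ (p ◅◅ q , r))
      step p (inj₂ (inj₂ (q , r))) = inj₂ (inj₂ (p ◅◅ q , r))

      cross : ∀ {w} → Joined (a , b) es b w → Joined (a , b) es a w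
      cross (inj₁ p)              = inj₂ (inj₁ (ε , p))
      cross (inj₂ (inj₁ (p , q))) = inj₂ (inj₁ (ε , q))
      cross (inj₂ (inj₂ (p , q))) = inj₁ q

      cross′ : ∀ {w} → Joined (a , b) es a w → Joined (a , b) es b w
      cross′ (inj₁ p)              = inj₂ (inj₂ (ε , p))
      cross′ (inj₂ (inj₁ (p , q))) = inj₁ q
      cross′ (inj₂ (inj₂ (p , q))) = inj₂ (inj₂ (ε , q))

    eqClosure⇒joined : ∀ {u v} → EqClosure (Along ((a , b) ∷ es)) u v → Joined (a , b) es u v
    eqClosure⇒joined ε                      = inj₁ ε
    eqClosure⇒joined (fwd (here refl) ◅ ps) = cross (eqClosure⇒joined ps)
    eqClosure⇒joined (bwd (here refl) ◅ ps) = cross′ (eqClosure⇒joined ps)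
    eqClosure⇒joined (fwd (there p) ◅ ps)   = step (fwd p ◅ ε) (eqClosure⇒joined ps)
    eqClosure⇒joined (bwd (there p) ◅ ps)   = step (bwd p ◅ ε) (eqClosure⇒joined ps)

  eqClosure? : ∀ es → Binary.Decidable (EqClosure (Along es))
  eqClosure? [] u v = map′ (λ { refl → ε }) (λ { ε → refl ; (fwd () ◅ _) ; (bwd () ◅ _) }) (u ≟ v)
  eqClosure? ((a , b) ∷ es) u v =
    map′ (joined⇒eqClosure a b es) (eqClosure⇒joined a b es)
      (eqClosure? es u v
        ⊎-dec ((eqClosure? es u a ×-dec eqClosure? es b v)
        ⊎-dec (eqClosure? es u b ×-dec eqClosure? es a v)))

module _ (G : Graph) where
  open Graph G

  Adjacent : Subset #E → Rel (Fin #V) 0ℓ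
  Adjacent A u v = ∃[ e ] e ∈ A × ends e ≡ (u , v)

  Connected : Subset #E → Rel (Fin #V) 0ℓ
  Connected A = EqClosure (Adjacent A)

  private
    edgeList : Subset #E → List (Fin #V × Fin #V)
    edgeList A = map ends (filter (_∈? A) (allFin #E))

    along⇒adjacent : ∀ A {u v} → Along (edgeList A) u v → Adjacent A u v
    along⇒adjacent A p with e , e∈ , eq ← ∈-map⁻ ends p =
      e , proj₂ (∈-filter⁻ (_∈? A) {xs = allFin #E} e∈) , sym eq

    adjacent⇒along : ∀ A {u v} → Adjacent A u v → Along (edgeList A) u v
    adjacent⇒along A (e , e∈A , refl) = ∈-map⁺ ends (∈-filter⁺ (_∈? A) (∈-allFin e) e∈A)

  connected? : ∀ A → Binary.Decidable (Connected A)
  connected? A u v =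
    map′ (Eq.map (along⇒adjacent A)) (Eq.map (adjacent⇒along A)) (eqClosure? (edgeList A) u v)

  -- The number of connected components of (V , A): one representative vertex
  -- is kept from each class of Connected A.
  k : Subset #E → ℕ
  k A = length (deduplicate (connected? A) (allFin #V))

  -- Truncated subtraction never truncates here or in rank, nullity and tutte,
  -- since k A ≤ |V|, r A ≤ r E and r A ≤ |A|.
  r : Subset #E → ℕ
  r A = #V ∸ k A

  rank : ℕ
  rank = r full

  nullity : ℕ
  nullity = #E ∸ rank

  incidences : Fin #E → Fin #V → ℕ
  incidences e v = at (proj₁ (ends e)) ℕ.+ at (proj₂ (ends e))
    where
    at : Fin #V → ℕ
    at u = if does (u ≟ v) then 1 else 0

  degree : Subset #E → Fin #V → ℕ
  degree A v = sum ℕ.+-0-rawMonoid λ e → if lookup A e then incidences e v else 0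

  Eulerian : Pred (Subset #E) 0ℓ
  Eulerian A = ∀ v → 2 ∣ degree A v

  eulerian? : Decidable Eulerian
  eulerian? A = all? λ v → 2 ∣? degree A v

  tutte : ℚ → ℚ → ℚ
  tutte x y = foldr _+_ 0ℚ (map term (subsets #E))
    where
    term : Subset #E → ℚ
    term A = (x - 1ℚ) ^ (rank ∸ r A) * (y - 1ℚ) ^ (∣ A ∣ ∸ r A)

------------------------------------------------------------------------
-- Probability for three independent uniform subsets, i.e. for the uniform
-- distribution on triples of subsets.  Events are decidable predicates.

Triple : ℕ → Set
Triple m = Subset m × Subset m × Subset m

triples : ∀ m → List (Triple m)
triples m = cartesianProduct (subsets m) (cartesianProduct (subsets m) (subsets m))

∅∈subsets : ∀ m → ∅ ∈ˡ subsets m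
∅∈subsets zero    = here refl
∅∈subsets (suc m) = ∈-++⁺ˡ (∈-map⁺ (outside ∷_) (∅∈subsets m))

∅∈triples : ∀ m → (∅ , ∅ , ∅) ∈ˡ triples m
∅∈triples m = ∈-cartesianProduct⁺ ∅∈ (∈-cartesianProduct⁺ ∅∈ ∅∈)
  where ∅∈ = ∅∈subsets m

∈⇒length≢0 : ∀ {A : Set} {x : A} {xs : List A} → x ∈ˡ xs → ℕ.NonZero (length xs)
∈⇒length≢0 (here _)  = _
∈⇒length≢0 (there _) = _

triples≢0 : ∀ m → ℕ.NonZero (length (triples m))
triples≢0 m = ∈⇒length≢0 (∅∈triples m)

module _ {m : ℕ} where

  ℙ : {P : Pred (Triple m) 0ℓ} → Decidable P → ℚ
  ℙ P? = (+ length (filter P? (triples m)) / length (triples m)) {{triples≢0 m}}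

  ℙ[_∣_] : {P D : Pred (Triple m) 0ℓ} → Decidable P → (D? : Decidable D) →
           .{{NonZero (ℙ D?)}} → ℚ
  ℙ[ P? ∣ D? ] = ℙ (P? ∩? D?) ÷ ℙ D?

  Bias : {P : Pred (Triple m) 0ℓ} → Decidable P → ℚ
  Bias P? = ℙ P? - ℙ (∁? P?)

  Bias[_∣_] : {P D : Pred (Triple m) 0ℓ} → Decidable P → (D? : Decidable D) →
              .{{NonZero (ℙ D?)}} → ℚ
  Bias[ P? ∣ D? ] = ℙ[ P? ∣ D? ] - ℙ[ ∁? P? ∣ D? ]

  ℙ-nonZero : {P : Pred (Triple m) 0ℓ} (P? : Decidable P) → P (∅ , ∅ , ∅) → NonZero (ℙ P?)
  ℙ-nonZero P? p = ℚ.pos⇒nonZero (ℙ P?)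
    {{ℚ.normalize-pos (length (filter P? (triples m))) (length (triples m))
        {{triples≢0 m}} {{∈⇒length≢0 (∈-filter⁺ P? (∅∈triples m) p)}}}}

  SizeMod3 : ℕ → Pred (Triple m) 0ℓ
  SizeMod3 i (A , B , C) = (∣ A ∣ ℕ.+ ∣ B ∣ ℕ.+ ∣ C ∣) % 3 ≡ i

  sizeMod3? : ∀ i → Decidable (SizeMod3 i)
  sizeMod3? i (A , B , C) = (∣ A ∣ ℕ.+ ∣ B ∣ ℕ.+ ∣ C ∣) % 3 ℕ.≟ i

module _ (G : Graph) where
  open Graph G

  Δ : Pred (Triple #E) 0ℓ
  Δ (A , B , C) = Eulerian G (A △ B) × Eulerian G (B △ C)

  Δ? : Decidable Δ
  Δ? (A , B , C) = eulerian? G (A △ B) ×-dec eulerian? G (B △ C)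

  eulerian-∅△∅ : Eulerian G (∅ △ ∅)
  eulerian-∅△∅ v = subst (2 ∣_) (sym (degree≡0 (λ e → incidences G e v))) (2 ∣0)
    where
    degree≡0 : ∀ {m} (f : Fin m → ℕ) →
      sum ℕ.+-0-rawMonoid (λ e → if lookup (∅ △ ∅) e then f e else 0) ≡ 0
    degree≡0 {zero}  f = refl
    degree≡0 {suc m} f = degree≡0 (λ e → f (Fin.suc e))

  ℙΔ≢0 : NonZero (ℙ Δ?)
  ℙΔ≢0 = ℙ-nonZero Δ? (eulerian-∅△∅ , eulerian-∅△∅)

{-# OPTIONS --safe #-}
module Submission where

-- Fix ψ : ℕ → ℚ with ψ s + ψ (s+1) + ψ (s+2) = 0, for instance the difference of the indicators of
-- two residue classes modulo 3, which plays the role of a primitive cube root of unity.  Summing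
-- ψ (|A|+|B|+|C|) over the choice of B at one edge, with X = A △ B and Y = B △ C fixed, gives the
-- factor 2 if the edge is in neither X nor Y, and -1 otherwise.  Up to the sign (-1)^|E| the factor
-- on an edge outside X ∪ Y is therefore 1 + (-3), and expanding it turns the sum over Δ into
--   ψ 0 · (-1)^|E| · ∑_A (-3)^(|E|-|A|) · #{X ⊆ A eulerian}².
-- With #{X ⊆ A eulerian} = 2^(|A|-r(A)) this is the Tutte polynomial at (-2,-1/3), up to a power of
-- -3.  For ψ = [1]-[2] it vanishes since ψ 0 = 0.

open import Defs
import Algebra.Properties.CommutativeSemiring.Exp
open import Algebra.Bundles using (CommutativeRing)
open import Data.Bool.Base using (Bool; true; false; not; _∧_; _xor_; if_then_else_)
import Data.Bool.Properties as Bool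
open import Data.Bool.Solver using (module xor-∧-Solver)
open import Data.Fin.Base using (Fin; zero; suc)
import Data.Fin.Properties as Fin
open import Data.Fin.Subset using (Subset; _∈_; ⁅_⁆; ∁; ∣_∣; inside; outside) renaming (⊥ to ∅; ⊤ to full)
open import Data.Fin.Subset.Properties using (∣⊤∣≡n; ∣p∣≤n; ∣∁p∣≡n∸∣p∣; ∈⊤)
open import Data.Integer.Base as ℤ using (+_; -[1+_])
import Data.Integer.Properties as ℤ
open import Data.List.Base using (List; []; _∷_; _++_; length; map; filter; foldr; allFin; deduplicate; cartesianProduct)
open import Data.List.Membership.Propositional using (lose; find) renaming (_∈_ to _∈ˡ_)
open import Data.List.Membership.Propositional.Properties using (∈-allFin)
import Data.List.Properties as List
open import Data.List.Relation.Unary.All as All using (All; []; _∷_)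
import Data.List.Relation.Unary.All.Properties as All
open import Data.List.Relation.Unary.AllPairs as AllPairs using (AllPairs; []; _∷_)
import Data.List.Relation.Unary.AllPairs.Properties as AllPairs
open import Data.List.Relation.Unary.Any as Any using (Any; here; there; _─_)
import Data.List.Relation.Unary.Any.Properties as Any
import Data.List.Relation.Unary.Unique.Propositional.Properties as Unique
open import Data.Nat.Base as ℕ using (ℕ; zero; suc; s≤s; z≤n; _∸_)
open import Data.Nat.Divisibility using (_∣_; divides; ∣m∣n⇒∣m+n; ∣-refl; _∣0)
open import Data.Nat.DivMod using (_%_)
import Data.Nat.Properties as ℕ
import Data.Nat.Solver as ℕ
open import Data.Product.Base using (_×_; _,_; proj₁; proj₂; ∃-syntax; Σ-syntax)
open import Data.Rational.Base using (ℚ; 0ℚ; 1ℚ; ½; _+_; _-_; _*_; -_; _/_; _÷_; 1/_; NonZero; ≢-nonZero; toℚᵘ)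
import Data.Rational.Properties as ℚ
open import Data.Rational.Solver using (module +-*-Solver)
open import Data.Rational.Unnormalised.Base as ℚᵘ using (mkℚᵘ; *≡*)
import Data.Rational.Unnormalised.Properties as ℚᵘ
open import Data.Sum.Base using (_⊎_; inj₁; inj₂)
open import Data.Vec.Base using ([]; _∷_; here; there; lookup)
import Data.Vec.Properties as Vec
open import Function.Base using (_∘_; id)
open import Function.Bundles using (_⇔_; mk⇔)
open import Level using (0ℓ)
import Relation.Binary.Construct.Closure.Equivalence as Eq
open Eq using (EqClosure)
open import Relation.Binary.Construct.Closure.ReflexiveTransitive using (ε; _◅_)
open import Relation.Binary.Construct.Closure.Symmetric using (SymClosure; fwd; bwd)
open import Relation.Binary.Core using (Rel; _⇒_)
open import Relation.Binary.Definitions using () renaming (Decidable to Decidable₂)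
open import Relation.Binary.PropositionalEquality
open import Relation.Binary.Structures using (IsEquivalence)
open import Relation.Nullary.Decidable using (Dec; yes; no; does; does-⇔; dec-true; dec-false; _×-dec_)
open import Relation.Nullary.Negation using (¬_; contradiction)
open import Relation.Unary using (Pred; Decidable)
open import Relation.Unary.Properties using (∁?; _∩?_)

module Exp =
  Algebra.Properties.CommutativeSemiring.Exp (CommutativeRing.commutativeSemiring ℚ.+-*-commutativeRing)

-- Connected components

module _ {A : Set} {R : Rel A 0ℓ} (R-equiv : IsEquivalence R) where
  private module R = IsEquivalence R-equiv

  -- An entry related to both `x` and `y` would relate them by transitivity, so the deleted entry is
  -- not the one witnessing `y`.
  ─⁺ : ∀ {x y ys} (p : Any (R x) ys) → ¬ R x y → Any (R y) ys → Any (R y) (ys ─ p)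
  ─⁺ (here px) ¬xy (here py) = contradiction (R.trans px (R.sym py)) ¬xy
  ─⁺ (here px) ¬xy (there q) = q
  ─⁺ (there p) ¬xy (here py) = here py
  ─⁺ (there p) ¬xy (there q) = there (─⁺ p ¬xy q)

  length-─ : ∀ {x ys} (p : Any (R x) ys) → length ys ≡ suc (length (ys ─ p))
  length-─ (here px) = refl
  length-─ (there p) = cong suc (length-─ p)

  -- Pigeonhole: each `x` uses up its representative in `ys`, and by `─⁺` the later entries of `xs`,
  -- unrelated to it, keep theirs.
  independent≤covering : ∀ {xs ys} → AllPairs (λ x y → ¬ R x y) xs →
                         All (λ x → Any (R x) ys) xs → length xs ℕ.≤ length ys
  independent≤covering []         []       = z≤n
  independent≤covering (¬x ∷ ind) (p ∷ ps) = subst (_ ℕ.≤_) (sym (length-─ p))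
    (s≤s (independent≤covering ind (All.zipWith (λ (¬xy , q) → ─⁺ p ¬xy q) (¬x , ps))))

  independent-unique : ∀ {x y xs} → AllPairs (λ x y → ¬ R x y) xs →
                       x ∈ˡ xs → y ∈ˡ xs → R x y → x ≡ y
  independent-unique _          (here refl) (here refl) _  = refl
  independent-unique (¬x ∷ _)   (here refl) (there q)   xy = contradiction xy (All.lookup ¬x q)
  independent-unique (¬y ∷ _)   (there p)   (here refl) xy = contradiction (R.sym xy) (All.lookup ¬y p)
  independent-unique (_ ∷ ind)  (there p)   (there q)   xy = independent-unique ind p q xy

-- Classes are counted through transversals so that the particular list made by `deduplicate` never
-- matters: any two transversals of one equivalence relation have equal length.
record Transversal {A : Set} (R : Rel A 0ℓ) (xs : List A) : Set where
  field
    independent : AllPairs (λ x y → ¬ R x y) xs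
    covering    : ∀ x → Any (R x) xs

open Transversal

module _ {A : Set} {R R′ : Rel A 0ℓ} (R′-equiv : IsEquivalence R′) (R⇒R′ : R ⇒ R′) where

  coarser-transversal : ∀ {xs ys} → Transversal R xs → Transversal R′ ys → length ys ℕ.≤ length xs
  coarser-transversal t t′ = independent≤covering R′-equiv (independent t′)
    (All.tabulate λ {y} _ → Any.map R⇒R′ (covering t y))

module _ {A : Set} {R R′ : Rel A 0ℓ} (R-equiv : IsEquivalence R) (R′-equiv : IsEquivalence R′)
         (R⇒R′ : R ⇒ R′) where
  private
    module R = IsEquivalence R-equiv
    module R′ = IsEquivalence R′-equiv

  -- When R′ merges the classes of a and b, it has one representative c of the merged class; if c is in
  -- the class of a, then b is the one missing for R.
  split-transversal : ∀ {a b c xs} → (∀ {u v} → R′ u v → R u v ⊎ (R u a ⊎ R u b)) →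
                      R′ a b → ¬ R a b → c ∈ˡ xs → R a c →
                      Transversal R′ xs → Transversal R (b ∷ xs)
  split-transversal {a} {b} {c} {xs} R′⇒ ab ¬ab c∈ ac t = record
    { independent = All.tabulate ¬b ∷ AllPairs.map (_∘ R⇒R′) (independent t)
    ; covering    = cover
    }
    where
    ¬b : ∀ {d} → d ∈ˡ xs → ¬ R b d
    ¬b d∈ bd with refl ← independent-unique R′-equiv (independent t) c∈ d∈
                   (R′.trans (R′.sym (R⇒R′ ac)) (R′.trans ab (R⇒R′ bd))) =
      ¬ab (R.trans ac (R.sym bd))
    cover : ∀ v → Any (R v) (b ∷ xs)
    cover v with find (covering t v)
    ... | d , d∈ , vd with R′⇒ vd
    ...   | inj₁ vd       = there (lose d∈ vd)
    ...   | inj₂ (inj₁ va) = there (lose c∈ (R.trans va ac))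
    ...   | inj₂ (inj₂ vb) = here vb

module _ {n : ℕ} {R : Rel (Fin n) 0ℓ} (R-equiv : IsEquivalence R) (R? : Decidable₂ R) where
  private module R = IsEquivalence R-equiv

  deduplicate-independent : ∀ xs → AllPairs (λ x y → ¬ R x y) (deduplicate R? xs)
  deduplicate-independent []       = []
  deduplicate-independent (x ∷ xs) =
    All.all-filter _ (deduplicate R? xs) ∷ AllPairs.filter⁺ _ (deduplicate-independent xs)

  deduplicate-transversal : Transversal R (deduplicate R? (allFin n))
  deduplicate-transversal = record
    { independent = deduplicate-independent (allFin n)
    ; covering    = λ x → Any.deduplicate⁺ R? (λ zy xz → R.trans xz (R.sym zy))
                            (lose (∈-allFin x) R.refl)
    }

module _ {n : ℕ} where

  Edges : Set
  Edges = List (Fin n × Fin n)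

  infix 4 _⊢_~_
  _⊢_~_ : Edges → Rel (Fin n) 0ℓ
  es ⊢ u ~ v = EqClosure (Along es) u v

  ~-equiv : ∀ es → IsEquivalence (es ⊢_~_)
  ~-equiv es = Eq.isEquivalence (Along es)

  representatives : Edges → List (Fin n)
  representatives es = deduplicate (eqClosure? es) (allFin n)

  components : Edges → ℕ
  components es = length (representatives es)

  transversal : ∀ es → Transversal (es ⊢_~_) (representatives es)
  transversal es = deduplicate-transversal (~-equiv es) (eqClosure? es)

  weaken : ∀ {e es} → (es ⊢_~_) ⇒ (e ∷ es ⊢_~_)
  weaken = Eq.map there

  discrete : Transversal _≡_ (allFin n)
  discrete = record
    { independent = Unique.allFin⁺ n
    ; covering    = ∈-allFin
    }

  components≤n : ∀ es → components es ℕ.≤ n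
  components≤n es = subst (components es ℕ.≤_) (List.length-tabulate id)
    (coarser-transversal (~-equiv es) (λ { refl → ε }) discrete (transversal es))

  components-[] : components [] ≡ n
  components-[] = ℕ.≤-antisym (components≤n []) (subst (ℕ._≤ components []) (List.length-tabulate id)
    (coarser-transversal isEquivalence edgeless (transversal []) discrete))
    where
    edgeless : ([] ⊢_~_) ⇒ _≡_
    edgeless ε            = refl
    edgeless (fwd () ◅ _)
    edgeless (bwd () ◅ _)

  -- An edge inside a component relates no new pair, since any crossing of it can be rerouted within
  -- `es`.
  components-connected : ∀ {a b es} → es ⊢ a ~ b → components ((a , b) ∷ es) ≡ components es
  components-connected {a} {b} {es} ab = ℕ.≤-antisym
    (coarser-transversal (~-equiv _) weaken (transversal es) (transversal _))
    (coarser-transversal (~-equiv _) absorb (transversal _) (transversal es))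
    where
    module ~ = IsEquivalence (~-equiv es)
    absorb : ((a , b) ∷ es ⊢_~_) ⇒ (es ⊢_~_)
    absorb p with eqClosure⇒joined a b es p
    ... | inj₁ uv               = uv
    ... | inj₂ (inj₁ (ua , bv)) = ~.trans ua (~.trans ab bv)
    ... | inj₂ (inj₂ (ub , av)) = ~.trans ub (~.trans (~.sym ab) av)

  -- The new edge merges exactly the classes of `a` and `b`. The representative of the merged class
  -- lies in one of them, and `split-transversal` supplies the other.
  components-disconnected : ∀ {a b es} → ¬ es ⊢ a ~ b → components es ≡ suc (components ((a , b) ∷ es))
  components-disconnected {a} {b} {es} ¬ab = joined-length (find (covering t′ a))
    where
    module ~ = IsEquivalence (~-equiv es)
    es′ = (a , b) ∷ es
    t′ = transversal es′
    ab : es′ ⊢ a ~ b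
    ab = Eq.return (here refl)
    split : ∀ {u v} → es′ ⊢ u ~ v → es ⊢ u ~ v ⊎ (es ⊢ u ~ a ⊎ es ⊢ u ~ b)
    split p with eqClosure⇒joined a b es p
    ... | inj₁ uv              = inj₁ uv
    ... | inj₂ (inj₁ (ua , _)) = inj₂ (inj₁ ua)
    ... | inj₂ (inj₂ (ub , _)) = inj₂ (inj₂ ub)
    same : ∀ {xs} → Transversal (es ⊢_~_) xs → components es ≡ length xs
    same t = ℕ.≤-antisym (coarser-transversal (~-equiv es) id t (transversal es))
                         (coarser-transversal (~-equiv es) id (transversal es) t)
    swap-split : ∀ {u v} → es′ ⊢ u ~ v → es ⊢ u ~ v ⊎ (es ⊢ u ~ b ⊎ es ⊢ u ~ a)
    swap-split p with split p
    ... | inj₁ uv        = inj₁ uv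
    ... | inj₂ (inj₁ ua) = inj₂ (inj₂ ua)
    ... | inj₂ (inj₂ ub) = inj₂ (inj₁ ub)
    joined-length : ∃[ c ] c ∈ˡ representatives es′ × es′ ⊢ a ~ c →
                    components es ≡ suc (components es′)
    -- In the first two cases `c` lies in the class of `a`; in the last it lies in that of `b`, and
    -- the two ends exchange roles.
    joined-length (c , c∈ , ac) with eqClosure⇒joined a b es ac
    ... | inj₁ ac′ = same (split-transversal (~-equiv es) (~-equiv es′) weaken split ab ¬ab c∈ ac′ t′)
    ... | inj₂ (inj₂ (_ , ac′)) = same (split-transversal (~-equiv es) (~-equiv es′) weaken split ab ¬ab c∈ ac′ t′)
    ... | inj₂ (inj₁ (_ , bc)) = same (split-transversal (~-equiv es) (~-equiv es′) weaken swap-split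
            (IsEquivalence.sym (~-equiv es′) ab) (¬ab ∘ ~.sym) c∈ bc t′)

-- Even subgraphs

𝟙 : ∀ {P : Set} → Dec P → ℚ
𝟙 P? = if does P? then 1ℚ else 0ℚ

𝟙-yes : ∀ {P : Set} (P? : Dec P) → P → 𝟙 P? ≡ 1ℚ
𝟙-yes P? p = cong (if_then 1ℚ else 0ℚ) (dec-true P? p)

𝟙-no : ∀ {P : Set} (P? : Dec P) → ¬ P → 𝟙 P? ≡ 0ℚ
𝟙-no P? ¬p = cong (if_then 1ℚ else 0ℚ) (dec-false P? ¬p)

𝟙-⇔ : ∀ {P Q : Set} → P ⇔ Q → (P? : Dec P) (Q? : Dec Q) → 𝟙 P? ≡ 𝟙 Q?
𝟙-⇔ P⇔Q P? Q? = cong (if_then 1ℚ else 0ℚ) (does-⇔ P⇔Q P? Q?)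

𝟙-× : ∀ {P Q : Set} (P? : Dec P) (Q? : Dec Q) → 𝟙 (P? ×-dec Q?) ≡ 𝟙 P? * 𝟙 Q?
𝟙-× (yes _) (yes _) = refl
𝟙-× (yes _) (no _)  = refl
𝟙-× (no _)  (yes _) = refl
𝟙-× (no _)  (no _)  = refl

module _ {n : ℕ} where

  △-assoc : (A B C : Subset n) → (A △ B) △ C ≡ A △ (B △ C)
  △-assoc = Vec.zipWith-assoc Bool.xor-assoc

  △-comm : (A B : Subset n) → A △ B ≡ B △ A
  △-comm = Vec.zipWith-comm Bool.xor-comm

  △-identityˡ : (A : Subset n) → ∅ △ A ≡ A
  △-identityˡ = Vec.zipWith-identityˡ Bool.xor-identityˡ

  △-identityʳ : (A : Subset n) → A △ ∅ ≡ A
  △-identityʳ = Vec.zipWith-identityʳ Bool.xor-identityʳ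

△-self : ∀ {n} (A : Subset n) → A △ A ≡ ∅
△-self []      = refl
△-self (x ∷ A) = cong₂ _∷_ (Bool.xor-same x) (△-self A)

△-cancelʳ : ∀ {n} (A B : Subset n) → A △ B △ B ≡ A
△-cancelʳ A B = trans (△-assoc A B B) (trans (cong (A △_) (△-self B)) (△-identityʳ A))

△-swapʳ : ∀ {n} (A B C : Subset n) → A △ B △ C ≡ A △ C △ B
△-swapʳ A B C = trans (△-assoc A B C) (trans (cong (A △_) (△-comm B C)) (sym (△-assoc A C B)))

△-telescope : ∀ {n} (A B C : Subset n) → A △ B △ (B △ C) ≡ A △ C
△-telescope A B C = trans (sym (△-assoc (A △ B) B C)) (cong (_△ C) (△-cancelʳ A B))

-- The pairing over the field with two elements: the parity of the number of members of `T` at which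
-- `c` is true.
pair : ∀ {n} → (Fin n → Bool) → Subset n → Bool
pair c []      = false
pair c (t ∷ T) = (c zero ∧ t) xor pair (c ∘ suc) T

pair-△ : ∀ {n} (c : Fin n → Bool) (S T : Subset n) → pair c (S △ T) ≡ pair c S xor pair c T
pair-△ c []      []      = refl
pair-△ c (s ∷ S) (t ∷ T) = trans (cong ((c zero ∧ (s xor t)) xor_) (pair-△ (c ∘ suc) S T))
  (solve 5 (λ x s t u v → x :* (s :+ t) :+ (u :+ v) := x :* s :+ u :+ (x :* t :+ v)) refl
    (c zero) s t (pair (c ∘ suc) S) (pair (c ∘ suc) T))
  where open xor-∧-Solver

pair-∅ : ∀ {n} (c : Fin n → Bool) → pair c ∅ ≡ false
pair-∅ {zero}  c = refl
pair-∅ {suc n} c = cong₂ _xor_ (Bool.∧-zeroʳ (c zero)) (pair-∅ (c ∘ suc))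

pair-⁅⁆ : ∀ {n} (c : Fin n → Bool) a → pair c ⁅ a ⁆ ≡ c a
pair-⁅⁆ c zero    = trans (cong₂ _xor_ (Bool.∧-identityʳ (c zero)) (pair-∅ (c ∘ suc))) (Bool.xor-identityʳ (c zero))
pair-⁅⁆ c (suc a) = trans (cong (_xor pair (c ∘ suc) ⁅ a ⁆) (Bool.∧-zeroʳ (c zero))) (pair-⁅⁆ (c ∘ suc) a)

_≟ˢ_ : ∀ {n} (S T : Subset n) → Dec (S ≡ T)
_≟ˢ_ = Vec.≡-dec Bool._≟_

+-interchange₃ : ∀ x a y b z c →
  x ℕ.+ a ℕ.+ (y ℕ.+ b) ℕ.+ (z ℕ.+ c) ≡ x ℕ.+ y ℕ.+ z ℕ.+ (a ℕ.+ b ℕ.+ c)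
+-interchange₃ = solve 6
  (λ x a y b z c → x :+ a :+ (y :+ b) :+ (z :+ c) := x :+ y :+ z :+ (a :+ b :+ c)) refl
  where open ℕ.+-*-Solver

open +-*-Solver using (solve; con; _:=_; _:+_; _:-_; _:*_; :-_)

2ℚ 4ℚ -1ℚ -3ℚ -4/3 : ℚ
2ℚ   = + 2 / 1
4ℚ   = + 4 / 1
-1ℚ  = -[1+ 0 ] / 1
-3ℚ  = -[1+ 2 ] / 1
-4/3 = -[1+ 3 ] / 3

module _ {n : ℕ} where

  -- For a loop the two singletons cancel, in agreement with its contribution 2 to the degree.
  ∂ : Fin n × Fin n → Subset n
  ∂ (a , b) = ⁅ a ⁆ △ ⁅ b ⁆

  -- The number of sublists of es whose set of odd-degree vertices is T.
  joins : Edges {n} → Subset n → ℚ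
  joins []       T = 𝟙 (T ≟ˢ ∅)
  joins (e ∷ es) T = joins es T + joins es (T △ ∂ e)

  -- Toggling an occurrence of `e` is a bijection on sublists that changes the odd-degree set by
  -- `∂ e`; in the recursion it swaps the two summands at `e`.
  joins-△-edge : ∀ {e es} → e ∈ˡ es → ∀ T → joins es (T △ ∂ e) ≡ joins es T
  joins-△-edge {e} {_ ∷ es} (here refl) T =
    trans (cong (λ X → joins es (T △ ∂ e) + joins es X) (△-cancelʳ T (∂ e))) (ℚ.+-comm (joins es (T △ ∂ e)) (joins es T))
  joins-△-edge {e} {f ∷ es} (there e∈) T = cong₂ _+_ (joins-△-edge e∈ T)
    (trans (cong (joins es) (△-swapʳ T (∂ e) (∂ f))) (joins-△-edge e∈ (T △ ∂ f)))

  -- The boundaries of the edges along a path telescope to `∂ (a , b)`.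
  joins-△-path : ∀ {a b es} → es ⊢ a ~ b → ∀ T → joins es (T △ ∂ (a , b)) ≡ joins es T
  joins-△-path {a} {b} {es} ε T =
    cong (joins es) (trans (cong (T △_) (△-self ⁅ a ⁆)) (△-identityʳ T))
  joins-△-path {a} {b} {es} (_◅_ {j = c} s p) T = begin
    joins es (T △ ∂ (a , b))               ≡⟨ cong (λ X → joins es (T △ X)) (△-telescope ⁅ a ⁆ ⁅ c ⁆ ⁅ b ⁆) ⟨
    joins es (T △ (∂ (a , c) △ ∂ (c , b))) ≡⟨ cong (joins es) (△-assoc T _ _) ⟨
    joins es (T △ ∂ (a , c) △ ∂ (c , b))   ≡⟨ joins-△-path p _ ⟩
    joins es (T △ ∂ (a , c))               ≡⟨ step s ⟩
    joins es T                             ∎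
    where
    open ≡-Reasoning
    step : ∀ {c} → SymClosure (Along es) a c → joins es (T △ ∂ (a , c)) ≡ joins es T
    step     (fwd e∈) = joins-△-edge e∈ T
    step {c} (bwd e∈) =
      trans (cong (λ X → joins es (T △ X)) (△-comm ⁅ a ⁆ ⁅ c ⁆)) (joins-△-edge e∈ T)

  pair-∂ : ∀ c u v → pair c (∂ (u , v)) ≡ c u xor c v
  pair-∂ c u v = trans (pair-△ c ⁅ u ⁆ ⁅ v ⁆) (cong₂ _xor_ (pair-⁅⁆ c u) (pair-⁅⁆ c v))

  -- When `c` agrees on the ends of every edge, each `∂ e` pairs with it to `false`, and so does
  -- every attainable odd-degree set.
  joins-odd : ∀ (c : Fin n → Bool) {es} → All (λ (u , v) → c u ≡ c v) es →
              ∀ T → pair c T ≡ true → joins es T ≡ 0ℚ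
  joins-odd c []       T odd =
    𝟙-no (T ≟ˢ ∅) λ { refl → contradiction (trans (sym odd) (pair-∅ c)) λ () }
  joins-odd c {(u , v) ∷ es} (cu≡cv ∷ cs) T odd = trans
    (cong₂ _+_ (joins-odd c cs T odd) (joins-odd c cs (T △ ∂ (u , v)) odd′)) (ℚ.+-identityˡ 0ℚ)
    where
    open ≡-Reasoning
    odd′ : pair c (T △ ∂ (u , v)) ≡ true
    odd′ = begin
      pair c (T △ ∂ (u , v))          ≡⟨ pair-△ c T (∂ (u , v)) ⟩
      pair c T xor pair c (∂ (u , v)) ≡⟨ cong₂ _xor_ odd (pair-∂ c u v) ⟩
      true xor (c u xor c v)          ≡⟨ cong (λ x → true xor (x xor c v)) cu≡cv ⟩
      true xor (c v xor c v)          ≡⟨ cong (true xor_) (Bool.xor-same (c v)) ⟩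
      true                            ∎

  -- The indicator of the component of a agrees on the ends of every edge, but separates a from b.
  joins-disconnected : ∀ {a b es} → ¬ es ⊢ a ~ b → joins es (∂ (a , b)) ≡ 0ℚ
  joins-disconnected {a} {b} {es} ¬ab = joins-odd c (All.tabulate constant) (∂ (a , b))
    (trans (pair-∂ c a b) (cong₂ _xor_ (dec-true (a ~? a) ε) (dec-false (a ~? b) ¬ab)))
    where
    _~?_ = eqClosure? es
    c : Fin n → Bool
    c v = does (a ~? v)
    constant : ∀ {e} → e ∈ˡ es → c (proj₁ e) ≡ c (proj₂ e)
    constant {u , v} e∈ = does-⇔ (mk⇔ (λ au → trans~ au (Eq.return e∈)) (λ av → trans~ av (Eq.symmetric _ (Eq.return e∈))))
                        (a ~? u) (a ~? v)
      where trans~ = λ {u v w} → IsEquivalence.trans (~-equiv es) {u} {v} {w}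

  -- The size of the cycle space, found by adding one edge at a time. The exponent `ν` is the
  -- cyclomatic number, pinned down by Euler's relation in additive form.
  cycles : ∀ es → ∃[ ν ] joins es ∅ ≡ 2ℚ ^ ν × ν ℕ.+ n ≡ length es ℕ.+ components es
  cycles [] = 0 , 𝟙-yes (∅ {n} ≟ˢ ∅) refl , sym components-[]
  cycles ((a , b) ∷ es) with cycles es | eqClosure? es a b
  -- The edge closes a cycle: by `joins-△-path`, using it or not gives equal counts.
  ... | ν , count , euler | yes ab = suc ν
    , trans (cong₂ _+_ count (trans (joins-△-path ab ∅) count))
        (solve 1 (λ x → x :+ x := con 2ℚ :* x) refl (2ℚ ^ ν))
    , cong suc (trans euler (cong (length es ℕ.+_) (sym (components-connected ab))))
  -- The edge is a bridge: no even sublist uses it, and the loss of one component balances the added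
  -- edge.
  ... | ν , count , euler | no ¬ab = ν
    , trans (cong₂ _+_ count (trans (cong (joins es) (△-identityˡ _)) (joins-disconnected ¬ab))) (ℚ.+-identityʳ _)
    , trans euler (trans (cong (length es ℕ.+_) (components-disconnected ¬ab)) (ℕ.+-suc _ _))

-- Sums over subsets

infixl 9 _₀ _₁

_₀ _₁ : ∀ {m} {X : Set} → (Subset (suc m) → X) → Subset m → X
f ₀ = f ∘ (outside ∷_)
f ₁ = f ∘ (inside ∷_)

-- Opaque, since unification cannot solve for m through a function defined by recursion on m.
opaque
  ∑ : ∀ {m} → (Subset m → ℚ) → ℚ
  ∑ {zero}  f = f []
  ∑ {suc m} f = ∑ (f ₀) + ∑ (f ₁)

opaque
  unfolding ∑

  ∑-[] : (f : Subset 0 → ℚ) → ∑ f ≡ f []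
  ∑-[] f = refl

  ∑-suc : ∀ {m} (f : Subset (suc m) → ℚ) → ∑ f ≡ ∑ (f ₀) + ∑ (f ₁)
  ∑-suc f = refl

  ∑-cong : ∀ {m} {f g : Subset m → ℚ} → (∀ A → f A ≡ g A) → ∑ f ≡ ∑ g
  ∑-cong {zero}  eq = eq []
  ∑-cong {suc m} eq = cong₂ _+_ (∑-cong (eq ∘ (outside ∷_))) (∑-cong (eq ∘ (inside ∷_)))

  ∑-+ : ∀ {m} (f g : Subset m → ℚ) → ∑ (λ A → f A + g A) ≡ ∑ f + ∑ g
  ∑-+ {zero}  f g = refl
  ∑-+ {suc m} f g = trans (cong₂ _+_ (∑-+ (f ₀) (g ₀)) (∑-+ (f ₁) (g ₁)))
    (solve 4 (λ a b c d → a :+ b :+ (c :+ d) := a :+ c :+ (b :+ d)) refl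
      (∑ (f ₀)) (∑ (g ₀)) (∑ (f ₁)) (∑ (g ₁)))

  ∑-*ˡ : ∀ {m} c (f : Subset m → ℚ) → ∑ (λ A → c * f A) ≡ c * ∑ f
  ∑-*ˡ {zero}  c f = refl
  ∑-*ˡ {suc m} c f = trans (cong₂ _+_ (∑-*ˡ c (f ₀)) (∑-*ˡ c (f ₁))) (sym (ℚ.*-distribˡ-+ c _ _))

∑³ : ∀ {m} → (Subset m → Subset m → Subset m → ℚ) → ℚ
∑³ h = ∑ λ A → ∑ λ B → ∑ λ C → h A B C

∑³-cong : ∀ {m} {h h′ : Subset m → Subset m → Subset m → ℚ} →
          (∀ A B C → h A B C ≡ h′ A B C) → ∑³ h ≡ ∑³ h′
∑³-cong eq = ∑-cong λ A → ∑-cong λ B → ∑-cong (eq A B)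

∑³-+ : ∀ {m} (h h′ : Subset m → Subset m → Subset m → ℚ) →
       ∑³ (λ A B C → h A B C + h′ A B C) ≡ ∑³ h + ∑³ h′
∑³-+ h h′ = trans (∑-cong λ A → trans (∑-cong λ B → ∑-+ (h A B) (h′ A B)) (∑-+ _ _)) (∑-+ _ _)

∑³-[] : (h : Subset 0 → Subset 0 → Subset 0 → ℚ) → ∑³ h ≡ h [] [] []
∑³-[] h = trans (∑-[] _) (trans (∑-[] _) (∑-[] _))

∑³-suc : ∀ {m} (h : Subset (suc m) → Subset (suc m) → Subset (suc m) → ℚ) →
         let s = λ a b c → ∑³ λ A B C → h (a ∷ A) (b ∷ B) (c ∷ C)
             o = outside
             i = inside
         in ∑³ h ≡ s o o o + s o o i + (s o i o + s o i i) + (s i o o + s i o i + (s i i o + s i i i))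
∑³-suc h = trans (∑-suc _) (cong₂ _+_ (split outside) (split inside))
  where
  merge : ∀ a b → ∑ (λ A → ∑ λ B → ∑ λ C → h (a ∷ A) (b ∷ B) C)
                ≡ ∑³ (λ A B C → h (a ∷ A) (b ∷ B) (outside ∷ C))
                  + ∑³ (λ A B C → h (a ∷ A) (b ∷ B) (inside ∷ C))
  merge a b = trans (∑-cong λ A → trans (∑-cong λ B → ∑-suc _) (∑-+ _ _)) (∑-+ _ _)
  split : ∀ a → ∑ (λ A → ∑ λ B → ∑ λ C → h (a ∷ A) B C) ≡ _
  split a = trans (∑-cong λ A → ∑-suc _) (trans (∑-+ _ _) (cong₂ _+_ (merge a outside) (merge a inside)))

-- Sums over the subsets of a set, and the edge-by-edge recursion

∑⊆ : ∀ {m} → Subset m → (Subset m → ℚ) → ℚ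
∑⊆ []            f = f []
∑⊆ (outside ∷ A) f = ∑⊆ A (f ₀)
∑⊆ (inside ∷ A)  f = ∑⊆ A (f ₀) + ∑⊆ A (f ₁)

∑⊆-cong : ∀ {m} (A : Subset m) {f g} → (∀ X → f X ≡ g X) → ∑⊆ A f ≡ ∑⊆ A g
∑⊆-cong []            eq = eq []
∑⊆-cong (outside ∷ A) eq = ∑⊆-cong A (eq ∘ (outside ∷_))
∑⊆-cong (inside ∷ A)  eq = cong₂ _+_ (∑⊆-cong A (eq ∘ (outside ∷_))) (∑⊆-cong A (eq ∘ (inside ∷_)))

∑⊆-full : ∀ {m} (f : Subset m → ℚ) → ∑⊆ full f ≡ ∑ f
∑⊆-full {zero}  f = sym (∑-[] f)
∑⊆-full {suc m} f = trans (cong₂ _+_ (∑⊆-full (f ₀)) (∑⊆-full (f ₁))) (sym (∑-suc f))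

-- Exchanging the sums gives the sum over `X` and `Y` of `f X * g Y` times a factor -2 = 1 + (-3)
-- for each element outside both, which may lie in `A` or not. `f` and `g` are separate because the
-- recursion restricts them independently.
form : ∀ {m} → (Subset m → ℚ) → (Subset m → ℚ) → ℚ
form f g = ∑ λ A → -3ℚ ^ ∣ ∁ A ∣ * (∑⊆ A f * ∑⊆ A g)

form-[] : (f g : Subset 0 → ℚ) → form f g ≡ f [] * g []
form-[] f g = trans (∑-[] _) (ℚ.*-identityˡ _)

-- If the first element is outside `A`, both subsets avoid it, at weight -3; if it is inside, all
-- four combinations occur.
form-suc : ∀ {m} (f g : Subset (suc m) → ℚ) →
  form f g ≡ -3ℚ * form (f ₀) (g ₀)
             + (form (f ₀) (g ₀) + form (f ₀) (g ₁) + (form (f ₁) (g ₀) + form (f ₁) (g ₁)))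
form-suc f g = trans (∑-suc _) (cong₂ _+_
  (trans (∑-cong λ A → ℚ.*-assoc -3ℚ (-3ℚ ^ ∣ ∁ A ∣) (∑⊆ A (f ₀) * ∑⊆ A (g ₀))) (∑-*ˡ -3ℚ _))
  (trans (∑-cong λ A → solve 5 (λ w a b c d → w :* ((a :+ b) :* (c :+ d)) :=
                                   w :* (a :* c) :+ w :* (a :* d) :+ (w :* (b :* c) :+ w :* (b :* d))) refl
             (-3ℚ ^ ∣ ∁ A ∣) (∑⊆ A (f ₀)) (∑⊆ A (f ₁)) (∑⊆ A (g ₀)) (∑⊆ A (g ₁)))
         (trans (∑-+ _ _) (cong₂ _+_ (∑-+ _ _) (∑-+ _ _)))))

one : ∀ {m} → Subset m → ℚ
one _ = 1ℚ

form-one : ∀ m → form (one {m}) one ≡ 1ℚ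
form-one zero    = form-[] one one
-- Each element multiplies the value by -3 + 4 = 1.
form-one (suc m) = trans (form-suc (one {suc m}) one) (cong (λ x → -3ℚ * x + (x + x + (x + x))) (form-one m))

-- A triple is determined by `A △ B`, `B` and `B △ C`, which vary independently; the free choice of
-- `B` gives the power of 2. In the recursion each pair of restrictions arises twice.
∑³-△ : ∀ {m} (f g : Subset m → ℚ) →
       ∑³ (λ A B C → f (A △ B) * g (B △ C)) ≡ 2ℚ ^ m * (∑ f * ∑ g)
∑³-△ {zero}  f g = trans (∑³-[] _)
  (trans (cong₂ _*_ (sym (∑-[] f)) (sym (∑-[] g))) (sym (ℚ.*-identityˡ _)))
∑³-△ {suc m} f g = begin
  ∑³ (λ A B C → f (A △ B) * g (B △ C))
    ≡⟨ ∑³-suc (λ A B C → f (A △ B) * g (B △ C)) ⟩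
  s (f ₀) (g ₀) + s (f ₀) (g ₁) + (s (f ₁) (g ₁) + s (f ₁) (g ₀))
    + (s (f ₁) (g ₀) + s (f ₁) (g ₁) + (s (f ₀) (g ₁) + s (f ₀) (g ₀)))
    ≡⟨ cong₂ _+_ (cong₂ _+_ (cong₂ _+_ (∑³-△ _ _) (∑³-△ _ _)) (cong₂ _+_ (∑³-△ _ _) (∑³-△ _ _)))
                 (cong₂ _+_ (cong₂ _+_ (∑³-△ _ _) (∑³-△ _ _)) (cong₂ _+_ (∑³-△ _ _) (∑³-△ _ _))) ⟩
  t (f ₀) (g ₀) + t (f ₀) (g ₁) + (t (f ₁) (g ₁) + t (f ₁) (g ₀))
    + (t (f ₁) (g ₀) + t (f ₁) (g ₁) + (t (f ₀) (g ₁) + t (f ₀) (g ₀)))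
    ≡⟨ solve 5 (λ w a b c d →
         w :* (a :* c) :+ w :* (a :* d) :+ (w :* (b :* d) :+ w :* (b :* c))
           :+ (w :* (b :* c) :+ w :* (b :* d) :+ (w :* (a :* d) :+ w :* (a :* c)))
         := con 2ℚ :* w :* ((a :+ b) :* (c :+ d))) refl
         (2ℚ ^ m) (∑ (f ₀)) (∑ (f ₁)) (∑ (g ₀)) (∑ (g ₁)) ⟩
  2ℚ ^ suc m * ((∑ (f ₀) + ∑ (f ₁)) * (∑ (g ₀) + ∑ (g ₁)))
    ≡⟨ cong (2ℚ ^ suc m *_) (cong₂ _*_ (∑-suc f) (∑-suc g)) ⟨
  2ℚ ^ suc m * (∑ f * ∑ g) ∎
  where
  open ≡-Reasoning
  s t : (Subset m → ℚ) → (Subset m → ℚ) → ℚ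
  s f g = ∑³ (λ A B C → f (A △ B) * g (B △ C))
  t f g = 2ℚ ^ m * (∑ f * ∑ g)

weighted : ∀ {m} → (ℕ → ℚ) → (Subset m → ℚ) → (Subset m → ℚ) → ℚ
weighted ψ f g = ∑³ λ A B C → ψ (∣ A ∣ ℕ.+ ∣ B ∣ ℕ.+ ∣ C ∣) * (f (A △ B) * g (B △ C))

-- The shift counts how many of `A`, `B`, `C` contain the first element; the restrictions record its
-- membership in `A △ B` and `B △ C`.
weighted-suc : ∀ {m} ψ (f g : Subset (suc m) → ℚ) → let w = λ k → weighted {m} (ψ ∘ (k ℕ.+_)) in
  weighted ψ f g ≡ w 0 (f ₀) (g ₀) + w 1 (f ₀) (g ₁) + (w 1 (f ₁) (g ₁) + w 2 (f ₁) (g ₀))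
                   + (w 1 (f ₁) (g ₀) + w 2 (f ₁) (g ₁) + (w 2 (f ₀) (g ₁) + w 3 (f ₀) (g ₀)))
weighted-suc {m} ψ f g = trans (∑³-suc _) (cong₂ _+_
  (cong₂ _+_ (cong₂ _+_ (shift 0 0 0 (f ₀) (g ₀)) (shift 0 0 1 (f ₀) (g ₁)))
             (cong₂ _+_ (shift 0 1 0 (f ₁) (g ₁)) (shift 0 1 1 (f ₁) (g ₀))))
  (cong₂ _+_ (cong₂ _+_ (shift 1 0 0 (f ₁) (g ₀)) (shift 1 0 1 (f ₁) (g ₁)))
             (cong₂ _+_ (shift 1 1 0 (f ₀) (g ₁)) (shift 1 1 1 (f ₀) (g ₀)))))
  where
  shift : ∀ x y z (f g : Subset m → ℚ) →
    ∑³ (λ A B C → ψ (x ℕ.+ ∣ A ∣ ℕ.+ (y ℕ.+ ∣ B ∣) ℕ.+ (z ℕ.+ ∣ C ∣)) * (f (A △ B) * g (B △ C)))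
      ≡ weighted (ψ ∘ (x ℕ.+ y ℕ.+ z ℕ.+_)) f g
  shift x y z f g = ∑³-cong λ A B C → cong (λ s → ψ s * (f (A △ B) * g (B △ C)))
    (+-interchange₃ x (∣ A ∣) y (∣ B ∣) z (∣ C ∣))

-- Quantified over `ψ` because removing an element replaces `ψ` by its shifts, which satisfy the
-- same relation. The eight cases give `ψ 0 + ψ 3` for the pair `f ₀`, `g ₀` and `ψ 1 + ψ 2` for
-- each other pair, that is, `ψ 0` times 2 and -1.
weighted-form : ∀ {m} ψ → (∀ s → ψ s + ψ (1 ℕ.+ s) + ψ (2 ℕ.+ s) ≡ 0ℚ) → (f g : Subset m → ℚ) →
                weighted ψ f g ≡ ψ 0 * -1ℚ ^ m * form f g
weighted-form {zero}  ψ zs f g = trans (∑³-[] _)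
  (cong₂ _*_ (sym (ℚ.*-identityʳ (ψ 0))) (sym (form-[] f g)))
weighted-form {suc m} ψ zs f g = begin
  weighted ψ f g
    ≡⟨ weighted-suc ψ f g ⟩
  _ ≡⟨ cong₂ _+_ (cong₂ _+_ (cong₂ _+_ (ih 0 _ _) (ih 1 _ _)) (cong₂ _+_ (ih 1 _ _) (ih 2 _ _)))
                 (cong₂ _+_ (cong₂ _+_ (ih 1 _ _) (ih 2 _ _)) (cong₂ _+_ (ih 2 _ _) (ih 3 _ _))) ⟩
  combine (ψ 2) (ψ 3)
    ≡⟨ cong₂ combine p₂ p₃ ⟩
  combine (- (ψ 0 + ψ 1)) (ψ 0)
    -- Now `ψ 1` cancels, and extracting -1 leaves the coefficients -2, 1, 1, 1 of `form-suc`.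
    ≡⟨ solve 7 (λ p₀ p₁ e a b c d → let p₂ = :- (p₀ :+ p₁) in
         p₀ :* e :* a :+ p₁ :* e :* b :+ (p₁ :* e :* d :+ p₂ :* e :* c)
           :+ (p₁ :* e :* c :+ p₂ :* e :* d :+ (p₂ :* e :* b :+ p₀ :* e :* a))
         := p₀ :* (con -1ℚ :* e) :* (con -3ℚ :* a :+ (a :+ b :+ (c :+ d)))) refl
         (ψ 0) (ψ 1) (-1ℚ ^ m) (form (f ₀) (g ₀)) (form (f ₀) (g ₁)) (form (f ₁) (g ₀)) (form (f ₁) (g ₁)) ⟩
  ψ 0 * -1ℚ ^ suc m * (-3ℚ * form (f ₀) (g ₀)
    + (form (f ₀) (g ₀) + form (f ₀) (g ₁) + (form (f ₁) (g ₀) + form (f ₁) (g ₁))))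
    ≡⟨ cong (ψ 0 * -1ℚ ^ suc m *_) (form-suc f g) ⟨
  ψ 0 * -1ℚ ^ suc m * form f g ∎
  where
  open ≡-Reasoning
  combine : ℚ → ℚ → ℚ
  combine p₂ p₃ = w (ψ 0) (f ₀) (g ₀) + w (ψ 1) (f ₀) (g ₁) + (w (ψ 1) (f ₁) (g ₁) + w p₂ (f ₁) (g ₀))
                  + (w (ψ 1) (f ₁) (g ₀) + w p₂ (f ₁) (g ₁) + (w p₂ (f ₀) (g ₁) + w p₃ (f ₀) (g ₀)))
    where
    w : ℚ → (Subset m → ℚ) → (Subset m → ℚ) → ℚ
    w p f g = p * -1ℚ ^ m * form f g
  zs-shift : ∀ k s → ψ (k ℕ.+ s) + ψ (k ℕ.+ (1 ℕ.+ s)) + ψ (k ℕ.+ (2 ℕ.+ s)) ≡ 0ℚ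
  zs-shift k s rewrite ℕ.+-suc k (suc s) | ℕ.+-suc k s = zs (k ℕ.+ s)
  ih : ∀ k (f g : Subset m → ℚ) → weighted (ψ ∘ (k ℕ.+_)) f g ≡ ψ (k ℕ.+ 0) * -1ℚ ^ m * form f g
  ih k f g = weighted-form (ψ ∘ (k ℕ.+_)) (zs-shift k) f g
  third : ∀ x y z → x + y + z ≡ 0ℚ → z ≡ - (x + y)
  third x y z eq = trans (solve 3 (λ x y z → z := x :+ y :+ z :- (x :+ y)) refl x y z)
    (trans (cong (_- (x + y)) eq) (ℚ.+-identityˡ _))
  p₂ : ψ 2 ≡ - (ψ 0 + ψ 1)
  p₂ = third (ψ 0) (ψ 1) (ψ 2) (zs 0)
  p₃ : ψ 3 ≡ ψ 0
  p₃ = trans (third (ψ 1) (ψ 2) (ψ 3) (zs 1)) (trans (cong (λ x → - (ψ 1 + x)) p₂)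
    (solve 2 (λ x y → :- (y :+ :- (x :+ y)) := x) refl (ψ 0) (ψ 1)))

-- Graphs as edge lists

-- Recursion on the subset keeps this list in step with `∑⊆` and `joins`; `k≡components` links it to
-- the connectivity of the graph.
edges : ∀ {m n} → (Fin m → Fin n × Fin n) → Subset m → Edges {n}
edges ends []            = []
edges ends (outside ∷ A) = edges (ends ∘ suc) A
edges ends (inside ∷ A)  = ends zero ∷ edges (ends ∘ suc) A

length-edges : ∀ {m n} (ends : Fin m → Fin n × Fin n) A → length (edges ends A) ≡ ∣ A ∣
length-edges ends []            = refl
length-edges ends (outside ∷ A) = length-edges (ends ∘ suc) A
length-edges ends (inside ∷ A)  = cong suc (length-edges (ends ∘ suc) A)

∈-edges⁺ : ∀ {m n} (ends : Fin m → Fin n × Fin n) {A e} → e ∈ A → ends e ∈ˡ edges ends A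
∈-edges⁺ ends               here       = here refl
∈-edges⁺ ends {outside ∷ A} (there e∈) = ∈-edges⁺ (ends ∘ suc) e∈
∈-edges⁺ ends {inside ∷ A}  (there e∈) = there (∈-edges⁺ (ends ∘ suc) e∈)

∈-edges⁻ : ∀ {m n} (ends : Fin m → Fin n × Fin n) A {p} → p ∈ˡ edges ends A → ∃[ e ] e ∈ A × ends e ≡ p
∈-edges⁻ ends (outside ∷ A) p∈ with e , e∈ , eq ← ∈-edges⁻ (ends ∘ suc) A p∈ = suc e , there e∈ , eq
∈-edges⁻ ends (inside ∷ A) (here refl) = zero , here , refl
∈-edges⁻ ends (inside ∷ A) (there p∈) with e , e∈ , eq ← ∈-edges⁻ (ends ∘ suc) A p∈ = suc e , there e∈ , eq

-- The boundary map over the field with two elements; `lookup-boundary` identifies its value as the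
-- set of odd-degree vertices.
boundary : ∀ {m n} → (Fin m → Fin n × Fin n) → Subset m → Subset n
boundary ends []            = ∅
boundary ends (outside ∷ X) = boundary (ends ∘ suc) X
boundary ends (inside ∷ X)  = boundary (ends ∘ suc) X △ ∂ (ends zero)

-- `T` is arbitrary because including an edge moves its `∂` to the other side of the equation.
∑⊆-boundary : ∀ {m n} (ends : Fin m → Fin n × Fin n) A T →
              ∑⊆ A (λ X → 𝟙 (T ≟ˢ boundary ends X)) ≡ joins (edges ends A) T
∑⊆-boundary ends []            T = refl
∑⊆-boundary ends (outside ∷ A) T = ∑⊆-boundary (ends ∘ suc) A T
∑⊆-boundary ends (inside ∷ A)  T = cong₂ _+_ (∑⊆-boundary (ends ∘ suc) A T)
  (trans (∑⊆-cong A λ X → 𝟙-⇔ (mk⇔ (moveˡ X) (moveʳ X)) (T ≟ˢ _) ((T △ ∂ e) ≟ˢ _))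
         (∑⊆-boundary (ends ∘ suc) A (T △ ∂ e)))
  where
  e = ends zero
  b = boundary (ends ∘ suc)
  moveˡ : ∀ X → T ≡ b X △ ∂ e → T △ ∂ e ≡ b X
  moveˡ X refl = △-cancelʳ (b X) (∂ e)
  moveʳ : ∀ X → T △ ∂ e ≡ b X → T ≡ b X △ ∂ e
  moveʳ X eq = trans (sym (△-cancelʳ T (∂ e))) (cong (_△ ∂ e) eq)

-- Parity of degrees, and the passage to the given graph

odd : ℕ → Bool
odd zero    = false
odd (suc n) = not (odd n)

odd-+ : ∀ m n → odd (m ℕ.+ n) ≡ odd m xor odd n
odd-+ zero    n = refl
odd-+ (suc m) n = trans (cong not (odd-+ m n)) (Bool.not-distribˡ-xor (odd m) (odd n))

odd-if : ∀ b → odd (if b then 1 else 0) ≡ b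
odd-if false = refl
odd-if true  = refl

2∣⇒even : ∀ {n} → 2 ∣ n → odd n ≡ false
2∣⇒even (divides zero    refl) = refl
2∣⇒even (divides (suc q) refl) = trans (Bool.not-involutive _) (2∣⇒even (divides q refl))

even⇒2∣ : ∀ n → odd n ≡ false → 2 ∣ n
even⇒2∣ zero          _  = 2 ∣0
even⇒2∣ (suc (suc n)) eq = ∣m∣n⇒∣m+n ∣-refl (even⇒2∣ n (trans (sym (Bool.not-involutive _)) eq))

lookup-⁅⁆ : ∀ {n} (a v : Fin n) → lookup ⁅ a ⁆ v ≡ does (a Fin.≟ v)
lookup-⁅⁆ zero    zero    = refl
lookup-⁅⁆ zero    (suc v) = Vec.lookup-replicate v outside
lookup-⁅⁆ (suc a) zero    = refl
lookup-⁅⁆ (suc a) (suc v) = lookup-⁅⁆ a v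

lookup-ext : ∀ {n} {S T : Subset n} → (∀ v → lookup S v ≡ lookup T v) → S ≡ T
lookup-ext {S = S} {T} eq =
  trans (sym (Vec.tabulate∘lookup S)) (trans (Vec.tabulate-cong eq) (Vec.tabulate∘lookup T))

-- Lets `incidences` and `degree` be applied to the tail `ends ∘ suc` in the recursion on edges.
graph : ∀ {m n} → (Fin m → Fin n × Fin n) → Graph
graph {m} {n} ends = record { #V = n ; #E = m ; ends = ends }

lookup-∂ : ∀ {m n} (ends : Fin m → Fin n × Fin n) e v →
           lookup (∂ (ends e)) v ≡ odd (incidences (graph ends) e v)
lookup-∂ ends e v = begin
  lookup (⁅ a ⁆ △ ⁅ b ⁆) v                ≡⟨ Vec.lookup-zipWith _xor_ v ⁅ a ⁆ ⁅ b ⁆ ⟩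
  lookup ⁅ a ⁆ v xor lookup ⁅ b ⁆ v       ≡⟨ cong₂ _xor_ (side a) (side b) ⟩
  odd (at a) xor odd (at b)               ≡⟨ odd-+ (at a) (at b) ⟨
  odd (at a ℕ.+ at b)                     ∎
  where
  open ≡-Reasoning
  a = proj₁ (ends e)
  b = proj₂ (ends e)
  at : Fin _ → ℕ
  at u = if does (u Fin.≟ v) then 1 else 0
  side : ∀ u → lookup ⁅ u ⁆ v ≡ odd (at u)
  side u = trans (lookup-⁅⁆ u v) (sym (odd-if (does (u Fin.≟ v))))

lookup-boundary : ∀ {m n} (ends : Fin m → Fin n × Fin n) X v →
                  lookup (boundary ends X) v ≡ odd (degree (graph ends) X v)
lookup-boundary ends []            v = Vec.lookup-replicate v outside
lookup-boundary ends (outside ∷ X) v = lookup-boundary (ends ∘ suc) X v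
lookup-boundary ends (inside ∷ X)  v = begin
  lookup (boundary (ends ∘ suc) X △ ∂ (ends zero)) v
    ≡⟨ cong (λ S → lookup S v) (△-comm (boundary (ends ∘ suc) X) (∂ (ends zero))) ⟩
  lookup (∂ (ends zero) △ boundary (ends ∘ suc) X) v
    ≡⟨ Vec.lookup-zipWith _xor_ v (∂ (ends zero)) (boundary (ends ∘ suc) X) ⟩
  lookup (∂ (ends zero)) v xor lookup (boundary (ends ∘ suc) X) v
    ≡⟨ cong₂ _xor_ (lookup-∂ ends zero v) (lookup-boundary (ends ∘ suc) X v) ⟩
  odd (incidences (graph ends) zero v) xor odd (degree (graph (ends ∘ suc)) X v)
    ≡⟨ odd-+ (incidences (graph ends) zero v) (degree (graph (ends ∘ suc)) X v) ⟨
  odd (degree (graph ends) (inside ∷ X) v) ∎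
  where open ≡-Reasoning

module _ (G : Graph) where
  open Graph G

  eulerian⇔∂≡∅ : ∀ X → Eulerian G X ⇔ ∅ ≡ boundary ends X
  eulerian⇔∂≡∅ X = mk⇔
    (λ eul → lookup-ext λ v → trans (Vec.lookup-replicate v outside)
               (sym (trans (lookup-boundary ends X v) (2∣⇒even (eul v)))))
    (λ eq v → even⇒2∣ _ (trans (sym (lookup-boundary ends X v))
               (trans (cong (λ S → lookup S v) (sym eq)) (Vec.lookup-replicate v outside))))

  connected⇒~ : ∀ A → Connected G A ⇒ (edges ends A ⊢_~_)
  connected⇒~ A = Eq.map λ { (e , e∈ , refl) → ∈-edges⁺ ends e∈ }

  ~⇒connected : ∀ A → (edges ends A ⊢_~_) ⇒ Connected G A
  ~⇒connected A = Eq.map (∈-edges⁻ ends A)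

  -- The two relations contain each other, so their transversals bound one another in length.
  k≡components : ∀ A → k G A ≡ components (edges ends A)
  k≡components A = ℕ.≤-antisym
    (coarser-transversal (Eq.isEquivalence _) (~⇒connected A) (transversal _) connected-transversal)
    (coarser-transversal (~-equiv _) (connected⇒~ A) connected-transversal (transversal _))
    where
    connected-transversal = deduplicate-transversal (Eq.isEquivalence _) (connected? G A)

  k≤#V : ∀ A → k G A ℕ.≤ #V
  k≤#V A = subst (ℕ._≤ #V) (sym (k≡components A)) (components≤n (edges ends A))

  r≤rank : ∀ A → r G A ℕ.≤ rank G
  r≤rank A = ℕ.∸-monoʳ-≤ #V (coarser-transversal (Eq.isEquivalence _)
    (Eq.map λ (e , _ , eq) → e , ∈⊤ , eq)
    (deduplicate-transversal (Eq.isEquivalence _) (connected? G A))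
    (deduplicate-transversal (Eq.isEquivalence _) (connected? G full)))

  eul : Subset #E → ℚ
  eul X = 𝟙 (eulerian? G X)

  -- This is `cycles` for the edges of `A`, with Euler's relation rewritten through `r`; `ν` is |A|
  -- - r(A), stated additively.
  ∑⊆-eul : ∀ A → ∃[ ν ] ∑⊆ A eul ≡ 2ℚ ^ ν × ν ℕ.+ r G A ≡ ∣ A ∣
  ∑⊆-eul A with ν , count , euler ← cycles (edges ends A) = ν
    , trans (∑⊆-cong A λ X → 𝟙-⇔ (eulerian⇔∂≡∅ X) (eulerian? G X) (∅ ≟ˢ boundary ends X))
        (trans (∑⊆-boundary ends A ∅) count)
    , ℕ.+-cancelʳ-≡ (k G A) _ _ (begin
        ν ℕ.+ r G A ℕ.+ k G A   ≡⟨ ℕ.+-assoc ν (r G A) (k G A) ⟩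
        ν ℕ.+ (r G A ℕ.+ k G A) ≡⟨ cong (ν ℕ.+_) (ℕ.m∸n+n≡m (k≤#V A)) ⟩
        ν ℕ.+ #V                ≡⟨ euler ⟩
        length (edges ends A) ℕ.+ components (edges ends A)
                                ≡⟨ cong₂ ℕ._+_ (length-edges ends A) (sym (k≡components A)) ⟩
        ∣ A ∣ ℕ.+ k G A         ∎)
    where open ≡-Reasoning

-- Probabilities as normalised sums

-- Opaque, since unfolding the normalisation to lowest terms makes type checking slow.
opaque
  ι : ℕ → ℚ
  ι n = + n / 1

opaque
  unfolding ι

  ι-zero : ι 0 ≡ 0ℚ
  ι-zero = refl

  ι-suc : ∀ n → ι (suc n) ≡ 1ℚ + ι n
  ι-suc n = ℚ.toℚᵘ-injective (begin
    toℚᵘ (ι (suc n))              ≈⟨ ℚ.toℚᵘ-fromℚᵘ (mkℚᵘ (+ suc n) 0) ⟩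
    mkℚᵘ (+ suc n) 0              ≈⟨ *≡* (cong (λ x → (+ 1 ℤ.+ x) ℤ.* + 1) (sym (ℤ.*-identityʳ (+ n)))) ⟩
    ℚᵘ.1ℚᵘ ℚᵘ.+ mkℚᵘ (+ n) 0      ≈⟨ ℚᵘ.+-congʳ ℚᵘ.1ℚᵘ (ℚ.toℚᵘ-fromℚᵘ (mkℚᵘ (+ n) 0)) ⟨
    toℚᵘ 1ℚ ℚᵘ.+ toℚᵘ (ι n)       ≈⟨ ℚ.toℚᵘ-homo-+ 1ℚ (ι n) ⟨
    toℚᵘ (1ℚ + ι n)               ∎)
    where open ℚᵘ.≃-Reasoning

  ι*/ : ∀ a b .{{_ : ℕ.NonZero b}} → ι b * (+ a / b) ≡ ι a
  ι*/ a (suc b) = ℚ.toℚᵘ-injective (begin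
    toℚᵘ (ι (suc b) * (+ a / suc b))                ≈⟨ ℚ.toℚᵘ-homo-* (ι (suc b)) (+ a / suc b) ⟩
    toℚᵘ (ι (suc b)) ℚᵘ.* toℚᵘ (+ a / suc b)
      ≈⟨ ℚᵘ.*-cong (ℚ.toℚᵘ-fromℚᵘ (mkℚᵘ (+ suc b) 0)) (ℚ.toℚᵘ-fromℚᵘ (mkℚᵘ (+ a) b)) ⟩
    mkℚᵘ (+ suc b) 0 ℚᵘ.* mkℚᵘ (+ a) b
      ≈⟨ *≡* (trans (ℤ.*-identityʳ _) (trans (ℤ.*-comm (+ suc b) (+ a)) (cong (λ x → + a ℤ.* + suc x) (sym (ℕ.+-identityʳ b))))) ⟩
    mkℚᵘ (+ a) 0                                    ≈⟨ ℚ.toℚᵘ-fromℚᵘ (mkℚᵘ (+ a) 0) ⟨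
    toℚᵘ (ι a)                                      ∎)
    where open ℚᵘ.≃-Reasoning

sumˡ : ∀ {X : Set} → (X → ℚ) → List X → ℚ
sumˡ f xs = foldr _+_ 0ℚ (map f xs)

sumˡ-++ : ∀ {X : Set} (f : X → ℚ) xs ys → sumˡ f (xs ++ ys) ≡ sumˡ f xs + sumˡ f ys
sumˡ-++ f []       ys = sym (ℚ.+-identityˡ _)
sumˡ-++ f (x ∷ xs) ys = trans (cong (λ y → f x + y) (sumˡ-++ f xs ys)) (sym (ℚ.+-assoc (f x) (sumˡ f xs) (sumˡ f ys)))

sumˡ-map : ∀ {X Y : Set} (f : Y → ℚ) (g : X → Y) xs → sumˡ f (map g xs) ≡ sumˡ (f ∘ g) xs
sumˡ-map f g xs = cong (foldr _+_ 0ℚ) (sym (List.map-∘ xs))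

sumˡ-cartesianProduct : ∀ {X Y : Set} (f : X × Y → ℚ) xs ys →
  sumˡ f (cartesianProduct xs ys) ≡ sumˡ (λ x → sumˡ (λ y → f (x , y)) ys) xs
sumˡ-cartesianProduct f []       ys = refl
sumˡ-cartesianProduct f (x ∷ xs) ys = trans (sumˡ-++ f (map (x ,_) ys) (cartesianProduct xs ys))
  (cong₂ _+_ (sumˡ-map f (x ,_) ys) (sumˡ-cartesianProduct f xs ys))

sumˡ-subsets : ∀ {m} (f : Subset m → ℚ) → sumˡ f (subsets m) ≡ ∑ f
sumˡ-subsets {zero}  f = trans (ℚ.+-identityʳ (f [])) (sym (∑-[] f))
sumˡ-subsets {suc m} f = trans (sumˡ-++ f (map (outside ∷_) (subsets m)) (map (inside ∷_) (subsets m)))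
  (trans (cong₂ _+_ (trans (sumˡ-map f (outside ∷_) (subsets m)) (sumˡ-subsets (f ₀)))
                    (trans (sumˡ-map f (inside ∷_) (subsets m)) (sumˡ-subsets (f ₁))))
         (sym (∑-suc f)))

sumˡ-triples : ∀ {m} (f : Triple m → ℚ) → sumˡ f (triples m) ≡ ∑³ λ A B C → f (A , B , C)
sumˡ-triples {m} f = trans (sumˡ-cartesianProduct f (subsets m) (cartesianProduct (subsets m) (subsets m)))
  (trans (sumˡ-subsets {m} _) (∑-cong λ A →
   trans (sumˡ-cartesianProduct (λ p → f (A , p)) (subsets m) (subsets m))
  (trans (sumˡ-subsets {m} _) (∑-cong λ B → sumˡ-subsets λ C → f (A , B , C)))))

ι-length-filter : ∀ {X : Set} {P : Pred X 0ℓ} (P? : Decidable P) xs →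
                  ι (length (filter P? xs)) ≡ sumˡ (𝟙 ∘ P?) xs
ι-length-filter P? []       = ι-zero
ι-length-filter P? (x ∷ xs) with P? x
... | yes _ = trans (ι-suc (length (filter P? xs))) (cong (λ y → 1ℚ + y) (ι-length-filter P? xs))
... | no  _ = trans (ι-length-filter P? xs) (sym (ℚ.+-identityˡ (sumˡ (𝟙 ∘ P?) xs)))

ι-length : ∀ {X : Set} (xs : List X) → ι (length xs) ≡ sumˡ (λ _ → 1ℚ) xs
ι-length []       = ι-zero
ι-length (x ∷ xs) = trans (ι-suc (length xs)) (cong (λ y → 1ℚ + y) (ι-length xs))

#triples : ℕ → ℚ
#triples m = ι (length (triples m))

-- Multiplying by the number of triples clears the denominator, so that probabilities become sums of
-- indicators.
#triples*ℙ : ∀ {m} {P : Pred (Triple m) 0ℓ} (P? : Decidable P) →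
             #triples m * ℙ P? ≡ ∑³ λ A B C → 𝟙 (P? (A , B , C))
#triples*ℙ {m} P? = trans (ι*/ (length (filter P? (triples m))) (length (triples m)) {{triples≢0 m}})
  (trans (ι-length-filter P? (triples m)) (sumˡ-triples (𝟙 ∘ P?)))

∑-one : ∀ m → ∑ (one {m}) ≡ 2ℚ ^ m
∑-one zero    = ∑-[] one
∑-one (suc m) = trans (∑-suc (one {suc m})) (trans (cong₂ _+_ (∑-one m) (∑-one m))
  (solve 1 (λ x → x :+ x := con 2ℚ :* x) refl (2ℚ ^ m)))

#triples≡ : ∀ m → #triples m ≡ 2ℚ ^ m * (2ℚ ^ m * 2ℚ ^ m)
#triples≡ m = trans (ι-length (triples m)) (trans (sumˡ-triples (λ _ → 1ℚ))
  (trans (∑³-△ {m} one one) (cong (λ x → 2ℚ ^ m * (x * x)) (∑-one m))))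

-- Differences of biases modulo 3

residue : ℕ → ℕ → ℕ → ℚ
residue i j s = 𝟙 (s % 3 ℕ.≟ i) - 𝟙 (s % 3 ℕ.≟ j)

-- Three consecutive numbers meet each residue class once, and `% 3` computes with period 3.
residue₀₁ : ∀ s → residue 0 1 s + residue 0 1 (1 ℕ.+ s) + residue 0 1 (2 ℕ.+ s) ≡ 0ℚ
residue₀₁ 0 = refl
residue₀₁ 1 = refl
residue₀₁ 2 = refl
residue₀₁ (suc (suc (suc s))) = residue₀₁ s

residue₁₂ : ∀ s → residue 1 2 s + residue 1 2 (1 ℕ.+ s) + residue 1 2 (2 ℕ.+ s) ≡ 0ℚ
residue₁₂ 0 = refl
residue₁₂ 1 = refl
residue₁₂ 2 = refl
residue₁₂ (suc (suc (suc s))) = residue₁₂ s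

÷-*-cancel : ∀ p q .{{_ : NonZero q}} → (p ÷ q) * q ≡ p
÷-*-cancel p q = trans (ℚ.*-assoc p (1/ q) q) (trans (cong (p *_) (ℚ.*-inverseˡ q)) (ℚ.*-identityʳ p))

*⇒÷ : ∀ {p q s} .{{_ : NonZero q}} → p ≡ s * q → p ÷ q ≡ s
*⇒÷ {p} {q} {s} refl = trans (ℚ.*-assoc s q (1/ q)) (trans (cong (s *_) (ℚ.*-inverseʳ q)) (ℚ.*-identityʳ s))

-- An event and its complement add up to a mass that does not depend on the event and so cancels.
bias-difference : ∀ N a b a′ b′ → N * a + N * b ≡ N * a′ + N * b′ →
                  N * ((a - b) - (a′ - b′)) ≡ 2ℚ * (N * a - N * a′)
bias-difference N a b a′ b′ eq = trans
  (solve 5 (λ n a b a′ b′ → n :* ((a :- b) :- (a′ :- b′)) :=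
      con 2ℚ :* (n :* a :- n :* a′) :+ ((n :* a′ :+ n :* b′) :- (n :* a :+ n :* b))) refl N a b a′ b′)
  (trans (cong (λ x → 2ℚ * (N * a - N * a′) + (N * a′ + N * b′ - x)) eq)
    (solve 2 (λ x y → x :+ (y :- y) := x) refl (2ℚ * (N * a - N * a′)) (N * a′ + N * b′)))

module _ {m : ℕ} where
  private
    N = #triples m

  complementary : ∀ {P : Pred (Triple m) 0ℓ} (P? : Decidable P) →
                  N * ℙ P? + N * ℙ (∁? P?) ≡ ∑³ {m} (λ _ _ _ → 1ℚ)
  complementary P? = trans (cong₂ _+_ (#triples*ℙ P?) (#triples*ℙ (∁? P?)))
    (trans (sym (∑³-+ _ _)) (∑³-cong λ A B C → pointwise (A , B , C)))
    where
    pointwise : ∀ t → 𝟙 (P? t) + 𝟙 (∁? P? t) ≡ 1ℚ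
    pointwise t with P? t
    ... | yes _ = refl
    ... | no  _ = refl

  complementary-∩ : ∀ {P D : Pred (Triple m) 0ℓ} (P? : Decidable P) (D? : Decidable D) →
                    N * ℙ (P? ∩? D?) + N * ℙ (∁? P? ∩? D?) ≡ N * ℙ D?
  complementary-∩ P? D? = trans (cong₂ _+_ (#triples*ℙ (P? ∩? D?)) (#triples*ℙ (∁? P? ∩? D?)))
    (trans (sym (∑³-+ _ _)) (trans (∑³-cong λ A B C → pointwise (A , B , C)) (sym (#triples*ℙ D?))))
    where
    pointwise : ∀ t → 𝟙 ((P? ∩? D?) t) + 𝟙 ((∁? P? ∩? D?) t) ≡ 𝟙 (D? t)
    pointwise t with P? t | D? t
    ... | yes _ | yes _ = refl
    ... | yes _ | no  _ = refl
    ... | no  _ | yes _ = refl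
    ... | no  _ | no  _ = refl

  -- The general `f` serves both settings: `one` for the unconditional events, `eul G` for those
  -- intersected with `Δ`.
  residue-difference : ∀ i j (f : Subset m → ℚ) {P Q : Pred (Triple m) 0ℓ} (P? : Decidable P) (Q? : Decidable Q) →
    (∀ A B C → 𝟙 (P? (A , B , C)) ≡ 𝟙 (Q? (A , B , C)) + residue i j (∣ A ∣ ℕ.+ ∣ B ∣ ℕ.+ ∣ C ∣) * (f (A △ B) * f (B △ C))) →
    N * ℙ P? - N * ℙ Q? ≡ weighted (residue i j) f f
  residue-difference i j f P? Q? eq = begin
    N * ℙ P? - N * ℙ Q?      ≡⟨ cong₂ _-_ (trans (#triples*ℙ P?) (trans (∑³-cong eq) (∑³-+ _ _))) (#triples*ℙ Q?) ⟩
    q + weighted (residue i j) f f - q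
                             ≡⟨ solve 2 (λ x y → x :+ y :- x := y) refl q (weighted (residue i j) f f) ⟩
    weighted (residue i j) f f ∎
    where
    open ≡-Reasoning
    q = ∑³ λ A B C → 𝟙 (Q? (A , B , C))

  biasMod3 : ℕ → ℚ
  biasMod3 i = Bias (sizeMod3? {m} i)

  biasMod3-weighted : ∀ i j → N * (biasMod3 i - biasMod3 j) ≡ 2ℚ * weighted {m} (residue i j) one one
  biasMod3-weighted i j = trans
    (bias-difference N (ℙ (S i)) (ℙ (∁? (S i))) (ℙ (S j)) (ℙ (∁? (S j)))
      (trans (complementary (S i)) (sym (complementary (S j)))))
    (cong (2ℚ *_) (residue-difference i j one (S i) (S j) λ A B C →
      solve 2 (λ x y → x := y :+ (x :- y) :* (con 1ℚ :* con 1ℚ)) refl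
        (𝟙 (S i (A , B , C))) (𝟙 (S j (A , B , C)))))
    where
    S : ∀ i → Decidable (SizeMod3 {m} i)
    S = sizeMod3?

module _ (G : Graph) where
  open Graph G
  private
    N = #triples #E
    d = ℙ (Δ? G)

  biasMod3∣Δ : ℕ → ℚ
  biasMod3∣Δ i = Bias[ sizeMod3? i ∣ Δ? G ] {{ℙΔ≢0 G}}

  #Δ : N * d ≡ 2ℚ ^ #E * (∑ (eul G) * ∑ (eul G))
  #Δ = trans (#triples*ℙ (Δ? G)) (trans
    (∑³-cong λ A B C → 𝟙-× (eulerian? G (A △ B)) (eulerian? G (B △ C))) (∑³-△ (eul G) (eul G)))

  biasMod3∣Δ-weighted : ∀ i j → N * d * (biasMod3∣Δ i - biasMod3∣Δ j) ≡ 2ℚ * weighted (residue i j) (eul G) (eul G)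
  biasMod3∣Δ-weighted i j = begin
    N * d * (biasMod3∣Δ i - biasMod3∣Δ j)
      -- Moving `d` onto each quotient clears the denominators of the conditional probabilities.
      ≡⟨ solve 6 (λ n d x y x′ y′ → n :* d :* ((x :- y) :- (x′ :- y′)) :=
           n :* ((x :* d :- y :* d) :- (x′ :* d :- y′ :* d))) refl N d
           (a i ÷ d) (b i ÷ d) (a j ÷ d) (b j ÷ d) ⟩
    N * (((a i ÷ d) * d - (b i ÷ d) * d) - ((a j ÷ d) * d - (b j ÷ d) * d))
      ≡⟨ cong (N *_) (cong₂ _-_ (cong₂ _-_ (÷-*-cancel (a i) d) (÷-*-cancel (b i) d))
                               (cong₂ _-_ (÷-*-cancel (a j) d) (÷-*-cancel (b j) d))) ⟩
    N * ((a i - b i) - (a j - b j))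
      ≡⟨ bias-difference N (a i) (b i) (a j) (b j) (trans (complementary-∩ (S i) (Δ? G)) (sym (complementary-∩ (S j) (Δ? G)))) ⟩
    2ℚ * (N * a i - N * a j)
      ≡⟨ cong (2ℚ *_) (residue-difference i j (eul G) (S i ∩? Δ? G) (S j ∩? Δ? G) pointwise) ⟩
    2ℚ * weighted (residue i j) (eul G) (eul G) ∎
    where
    open ≡-Reasoning
    instance _ = ℙΔ≢0 G
    S : ∀ i → Decidable (SizeMod3 {#E} i)
    S = sizeMod3?
    a b : ℕ → ℚ
    a i = ℙ (S i ∩? Δ? G)
    b i = ℙ (∁? (S i) ∩? Δ? G)
    pointwise : ∀ A B C → 𝟙 ((S i ∩? Δ? G) (A , B , C)) ≡ 𝟙 ((S j ∩? Δ? G) (A , B , C))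
                  + residue i j (∣ A ∣ ℕ.+ ∣ B ∣ ℕ.+ ∣ C ∣) * (eul G (A △ B) * eul G (B △ C))
    pointwise A B C = begin
      𝟙 ((S i ∩? Δ? G) t) ≡⟨ 𝟙-× (S i t) (Δ? G t) ⟩
      𝟙 (S i t) * 𝟙 (Δ? G t)
        ≡⟨ solve 3 (λ x y z → x :* z := y :* z :+ (x :- y) :* z) refl (𝟙 (S i t)) (𝟙 (S j t)) (𝟙 (Δ? G t)) ⟩
      𝟙 (S j t) * 𝟙 (Δ? G t) + (𝟙 (S i t) - 𝟙 (S j t)) * 𝟙 (Δ? G t)
        ≡⟨ cong₂ (λ x y → x + (𝟙 (S i t) - 𝟙 (S j t)) * y) (sym (𝟙-× (S j t) (Δ? G t)))
             (𝟙-× (eulerian? G (A △ B)) (eulerian? G (B △ C))) ⟩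
      _ ∎
      where t = A , B , C

-- The Tutte polynomial at (-2, -1/3) and the comparison of the two bias gaps

inverse-^ : ∀ {x y} → x * y ≡ 1ℚ → ∀ n → x ^ n * y ^ n ≡ 1ℚ
inverse-^ {x} {y} xy≡1 zero = refl
inverse-^ {x} {y} xy≡1 (suc n) = trans
  (solve 4 (λ x y a b → x :* a :* (y :* b) := x :* y :* (a :* b)) refl x y (x ^ n) (y ^ n))
  (cong₂ _*_ xy≡1 (inverse-^ xy≡1 n))

-- At this point x - 1 = -3 and y - 1 = -4/3. Since (-3)(-4/3) = 4, setting aside `ν` factors -3
-- turns the power of -4/3 into the square of the cycle count `2ℚ ^ ν`.
tutte-weight : ∀ n s c ν → n ℕ.+ s ≡ c ℕ.+ ν →
               -3ℚ ^ n * (-3ℚ ^ s * -4/3 ^ ν) ≡ -3ℚ ^ c * (2ℚ ^ ν * 2ℚ ^ ν)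
tutte-weight n s c ν eq = begin
  -3ℚ ^ n * (-3ℚ ^ s * -4/3 ^ ν)   ≡⟨ ℚ.*-assoc (-3ℚ ^ n) (-3ℚ ^ s) (-4/3 ^ ν) ⟨
  -3ℚ ^ n * -3ℚ ^ s * -4/3 ^ ν     ≡⟨ cong (_* -4/3 ^ ν) (Exp.^-homo-* -3ℚ n s) ⟨
  -3ℚ ^ (n ℕ.+ s) * -4/3 ^ ν       ≡⟨ cong (λ k → -3ℚ ^ k * -4/3 ^ ν) eq ⟩
  -3ℚ ^ (c ℕ.+ ν) * -4/3 ^ ν       ≡⟨ cong (_* -4/3 ^ ν) (Exp.^-homo-* -3ℚ c ν) ⟩
  -3ℚ ^ c * -3ℚ ^ ν * -4/3 ^ ν     ≡⟨ ℚ.*-assoc (-3ℚ ^ c) (-3ℚ ^ ν) (-4/3 ^ ν) ⟩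
  -3ℚ ^ c * (-3ℚ ^ ν * -4/3 ^ ν)   ≡⟨ cong (-3ℚ ^ c *_) (Exp.^-distrib-* -3ℚ -4/3 ν) ⟨
  -3ℚ ^ c * 4ℚ ^ ν                 ≡⟨ cong (-3ℚ ^ c *_) (Exp.^-distrib-* 2ℚ 2ℚ ν) ⟩
  -3ℚ ^ c * (2ℚ ^ ν * 2ℚ ^ ν)      ∎
  where open ≡-Reasoning

module _ (G : Graph) where
  open Graph G

  private
    x = -[1+ 1 ] / 1
    y = -[1+ 0 ] / 3

  -- The case `full` of `∑⊆-eul` bounds the rank by the number of edges, so the subtraction in
  -- `nullity` is exact.
  nullity+rank : nullity G ℕ.+ rank G ≡ #E
  nullity+rank with ν , _ , eq ← ∑⊆-eul G full =
    ℕ.m∸n+n≡m (subst (rank G ℕ.≤_) (trans eq (∣⊤∣≡n #E)) (ℕ.m≤n+m (rank G) ν))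

  ∑-eul : ∑ (eul G) ≡ 2ℚ ^ nullity G
  ∑-eul with ν , count , eq ← ∑⊆-eul G full = trans (sym (∑⊆-full (eul G))) (trans count
    (cong (2ℚ ^_) (ℕ.+-cancelʳ-≡ (rank G) ν (nullity G) (trans eq (trans (∣⊤∣≡n #E) (sym nullity+rank))))))

  -- The identity holds term by term: the factor (-3)^n(G) raises the exponent of -3 to |E| - |A| +
  -- ν, as in `tutte-weight`.
  tutte-form : -3ℚ ^ nullity G * tutte G x y ≡ form (eul G) (eul G)
  tutte-form = trans (cong (-3ℚ ^ nullity G *_) (sumˡ-subsets {#E} term))
    (trans (sym (∑-*ˡ (-3ℚ ^ nullity G) term)) (∑-cong pointwise))
    where
    term : Subset #E → ℚ
    term A = (x - 1ℚ) ^ (rank G ∸ r G A) * (y - 1ℚ) ^ (∣ A ∣ ∸ r G A)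
    pointwise : ∀ A → -3ℚ ^ nullity G * term A
                      ≡ -3ℚ ^ ∣ ∁ A ∣ * (∑⊆ A (eul G) * ∑⊆ A (eul G))
    pointwise A with ν , count , eq ← ∑⊆-eul G A = begin
      -3ℚ ^ nullity G * (-3ℚ ^ (rank G ∸ r G A) * -4/3 ^ (∣ A ∣ ∸ r G A))
        ≡⟨ cong (λ k → -3ℚ ^ nullity G * (-3ℚ ^ (rank G ∸ r G A) * -4/3 ^ k))
             (trans (cong (_∸ r G A) (sym eq)) (ℕ.m+n∸n≡m ν (r G A))) ⟩
      -3ℚ ^ nullity G * (-3ℚ ^ (rank G ∸ r G A) * -4/3 ^ ν)
        ≡⟨ tutte-weight (nullity G) (rank G ∸ r G A) (∣ ∁ A ∣) ν exponents ⟩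
      -3ℚ ^ ∣ ∁ A ∣ * (2ℚ ^ ν * 2ℚ ^ ν)
        ≡⟨ cong (λ z → -3ℚ ^ ∣ ∁ A ∣ * (z * z)) count ⟨
      -3ℚ ^ ∣ ∁ A ∣ * (∑⊆ A (eul G) * ∑⊆ A (eul G)) ∎
      where
      open ≡-Reasoning
      exponents : nullity G ℕ.+ (rank G ∸ r G A) ≡ ∣ ∁ A ∣ ℕ.+ ν
      -- Both sides equal |E| - r(A), so r(A) is added to each.
      exponents = ℕ.+-cancelʳ-≡ (r G A) _ _ (begin
        nullity G ℕ.+ (rank G ∸ r G A) ℕ.+ r G A   ≡⟨ ℕ.+-assoc (nullity G) _ _ ⟩
        nullity G ℕ.+ (rank G ∸ r G A ℕ.+ r G A)   ≡⟨ cong (nullity G ℕ.+_) (ℕ.m∸n+n≡m (r≤rank G A)) ⟩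
        nullity G ℕ.+ rank G                       ≡⟨ nullity+rank ⟩
        #E                                         ≡⟨ ℕ.m∸n+n≡m (∣p∣≤n A) ⟨
        #E ∸ ∣ A ∣ ℕ.+ ∣ A ∣                       ≡⟨ cong₂ ℕ._+_ (sym (∣∁p∣≡n∸∣p∣ A)) (sym eq) ⟩
        ∣ ∁ A ∣ ℕ.+ (ν ℕ.+ r G A)                  ≡⟨ ℕ.+-assoc (∣ ∁ A ∣) ν (r G A) ⟨
        ∣ ∁ A ∣ ℕ.+ ν ℕ.+ r G A                    ∎)

  private
    M = 2ℚ ^ #E
    K = 2ℚ ^ nullity G
    N = #triples #E
    sign = -1ℚ ^ #E
    F = form (eul G) (eul G)

  #Δ≡ : N * ℙ (Δ? G) ≡ M * (K * K)
  #Δ≡ = trans (#Δ G) (cong (λ z → M * (z * z)) ∑-eul)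

  -- Splitting 2^|E| as 2^n(G) times 2^r(G) shows that `Δ` has probability 4^(-r(G)); this is the
  -- source of the factor 4^r(G).
  #triples≡#Δ*4^rank : N ≡ M * (K * K) * 4ℚ ^ rank G
  #triples≡#Δ*4^rank = begin
    N                             ≡⟨ #triples≡ #E ⟩
    M * (M * M)                   ≡⟨ cong (λ z → M * (z * z)) M≡ ⟩
    M * (K * R * (K * R))
      ≡⟨ solve 3 (λ m k r → m :* (k :* r :* (k :* r)) := m :* (k :* k) :* (r :* r)) refl M K R ⟩
    M * (K * K) * (R * R)         ≡⟨ cong (M * (K * K) *_) (Exp.^-distrib-* 2ℚ 2ℚ (rank G)) ⟨
    M * (K * K) * 4ℚ ^ rank G     ∎
    where
    open ≡-Reasoning
    R = 2ℚ ^ rank G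
    M≡ : M ≡ K * R
    M≡ = trans (cong (2ℚ ^_) (sym nullity+rank)) (Exp.^-homo-* 2ℚ (nullity G) (rank G))

  #Δ-cancel : ∀ {a b} → M * (K * K) * a ≡ M * (K * K) * b → a ≡ b
  #Δ-cancel {a} {b} eq = trans (sym (undo a)) (trans (cong (h *_) eq) (undo b))
    where
    -- `h` is an explicit inverse of `M * (K * K)`.
    h½ k½ h : ℚ
    h½ = ½ ^ #E
    k½ = ½ ^ nullity G
    h = h½ * (k½ * k½)
    undo : ∀ a → h * (M * (K * K) * a) ≡ a
    undo a = begin
      h * (M * (K * K) * a)
        ≡⟨ solve 5 (λ h k m n a → h :* (k :* k) :* (m :* (n :* n) :* a) := h :* m :* (k :* n :* (k :* n)) :* a)
             refl h½ k½ M K a ⟩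
      h½ * M * (k½ * K * (k½ * K)) * a
        ≡⟨ cong₂ (λ u v → u * (v * v) * a) (inverse-^ refl #E) (inverse-^ refl (nullity G)) ⟩
      1ℚ * a ≡⟨ ℚ.*-identityˡ a ⟩
      a ∎
      where open ≡-Reasoning

  biasMod3∣Δ₁≡biasMod3∣Δ₂ : biasMod3∣Δ G 1 ≡ biasMod3∣Δ G 2
  biasMod3∣Δ₁≡biasMod3∣Δ₂ = begin
    b₁             ≡⟨ solve 2 (λ u v → u := u :- v :+ v) refl b₁ b₂ ⟩
    b₁ - b₂ + b₂   ≡⟨ cong (_+ b₂) (#Δ-cancel (begin
      M * (K * K) * (b₁ - b₂)    ≡⟨ cong (_* (b₁ - b₂)) #Δ≡ ⟨
      N * ℙ (Δ? G) * (b₁ - b₂)   ≡⟨ biasMod3∣Δ-weighted G 1 2 ⟩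
      2ℚ * weighted (residue 1 2) (eul G) (eul G)
                                 ≡⟨ cong (2ℚ *_) (weighted-form (residue 1 2) residue₁₂ (eul G) (eul G)) ⟩
      -- The factor `0ℚ` is `residue 1 2 0`: the number 0 lies in neither class.
      2ℚ * (0ℚ * sign * F)       ≡⟨ solve 3 (λ s f w → con 2ℚ :* (con 0ℚ :* s :* f) := w :* con 0ℚ) refl sign F (M * (K * K)) ⟩
      M * (K * K) * 0ℚ           ∎)) ⟩
    0ℚ + b₂        ≡⟨ ℚ.+-identityˡ b₂ ⟩
    b₂             ∎
    where
    open ≡-Reasoning
    b₁ = biasMod3∣Δ G 1
    b₂ = biasMod3∣Δ G 2

  private
    Y = biasMod3 {#E} 0 - biasMod3 {#E} 1
    X = biasMod3∣Δ G 0 - biasMod3∣Δ G 1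

  -- Without conditioning both functions are constant, and `form-one` leaves only the sign.
  #triples*bias-gap : N * Y ≡ 2ℚ * sign
  #triples*bias-gap = trans (biasMod3-weighted 0 1) (cong (2ℚ *_) (trans (weighted-form {#E} (residue 0 1) residue₀₁ one one)
    (trans (cong (1ℚ * sign *_) (form-one #E)) (solve 1 (λ s → con 1ℚ :* s :* con 1ℚ := s) refl sign))))

  -- The sign is its own inverse, so a vanishing `Y` would force 2 = 0.
  bias-gap≢0 : NonZero Y
  bias-gap≢0 = ≢-nonZero λ Y≡0 → contradiction (begin
    2ℚ                 ≡⟨ cong (2ℚ *_) (inverse-^ refl #E) ⟨
    2ℚ * (sign * sign) ≡⟨ ℚ.*-assoc 2ℚ sign sign ⟨
    2ℚ * sign * sign   ≡⟨ cong (_* sign) #triples*bias-gap ⟨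
    N * Y * sign       ≡⟨ cong (λ z → N * z * sign) Y≡0 ⟩
    N * 0ℚ * sign      ≡⟨ solve 2 (λ n s → n :* con 0ℚ :* s := con 0ℚ) refl N sign ⟩
    0ℚ                 ∎) λ ()
    where open ≡-Reasoning

  -- Both gaps, once scaled, carry the factor `2ℚ * sign`. Trading it for `N * Y` and then `N` for
  -- `w * 4ℚ ^ rank G` leaves `w` to cancel.
  bias∣Δ-gap : X ≡ 4ℚ ^ rank G * F * Y
  bias∣Δ-gap = #Δ-cancel (begin
    w * X                      ≡⟨ cong (_* X) #Δ≡ ⟨
    N * ℙ (Δ? G) * X           ≡⟨ biasMod3∣Δ-weighted G 0 1 ⟩
    2ℚ * weighted (residue 0 1) (eul G) (eul G)
                               ≡⟨ cong (2ℚ *_) (weighted-form (residue 0 1) residue₀₁ (eul G) (eul G)) ⟩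
    2ℚ * (1ℚ * sign * F)       ≡⟨ solve 2 (λ s f → con 2ℚ :* (con 1ℚ :* s :* f) := con 2ℚ :* s :* f) refl sign F ⟩
    2ℚ * sign * F              ≡⟨ cong (_* F) #triples*bias-gap ⟨
    N * Y * F                  ≡⟨ cong (λ z → z * Y * F) #triples≡#Δ*4^rank ⟩
    w * 4ℚ ^ rank G * Y * F    ≡⟨ solve 4 (λ w q y f → w :* q :* y :* f := w :* (q :* f :* y)) refl w (4ℚ ^ rank G) Y F ⟩
    w * (4ℚ ^ rank G * F * Y)  ∎)
    where
    open ≡-Reasoning
    w = M * (K * K)

theorem2p16 : (G : Graph) →
    let bias : ℕ → ℚ
        bias i = Bias (sizeMod3? {Graph.#E G} i)
        bias∣Δ : ℕ → ℚ
        bias∣Δ i = Bias[ sizeMod3? i ∣ Δ? G ] {{ℙΔ≢0 G}}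
    in  (bias∣Δ 1 ≡ bias∣Δ 2)
        × (Σ[ nz ∈ NonZero (bias 0 - bias 1) ]
             (((bias∣Δ 0 - bias∣Δ 1) ÷ (bias 0 - bias 1)) {{nz}}
                ≡ (+ 4 / 1) ^ rank G * (-[1+ 2 ] / 1) ^ nullity G
                    * tutte G (-[1+ 1 ] / 1) (-[1+ 0 ] / 3)))
theorem2p16 G = biasMod3∣Δ₁≡biasMod3∣Δ₂ G , bias-gap≢0 G , trans (*⇒÷ {{bias-gap≢0 G}} (bias∣Δ-gap G))
  (trans (cong (4ℚ ^ rank G *_) (sym (tutte-form G))) (sym (ℚ.*-assoc (4ℚ ^ rank G) _ _)))
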